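{- Let $k$ and $s$ be constants and $c=\Theta(n^{ -\alpha})$ for some $\alpha\in(0,1)$. Let $\tau$ be the largest integer satisfying $\alpha\binom{\tau}{s-1}<1$ and suppose that $$T\ge\begin{cases} 2n^{\tau+1}c^{\binom{\tau+1}{s}}(3\log n)^{(k-\tau)(1+\epsilon)} & \text{if } k\ge\tau+1,\\ 2n^k c^{\binom{k}{s}}(\log n)^{1+\epsilon} & \text{if } k<\tau+1,\end{cases}$$ for some $\epsilon>0$. Then GREEDY-RANDOM-SAMPLING run with $T$ iterations terminates with $S=\mathrm{cl}_k(G)$ with probability $1-n^{ -\omega(1)}$ over the random bits of the algorithm GREEDY-RANDOM-SAMPLING and over the choice of random hypergraph $G\sim G(n,c,s)$.
   Context: Here $2\le s\le k$ are integers. $G(n,c,s)$ is the Erdős–Rényi distribution on $s$-uniform hypergraphs with vertex set $[n]$, in which each of the $\binom{n}{s}$ possible hyperedges is included independently with probability $c$. A $k$-clique of $G$ is a $k$-subset $W$ of vertices with $\binom{W}{s}\subseteq E(G)$; $\mathrm{cl}_k(G)$ is the set of $k$-cliques of $G$. For $A\subseteq[n]$, let $$\mathrm{CN}_G(A)=\{v\in V(G)\setminus A: B\cup\{v\}\in E(G)\text{ for all }(s-1)\text{ -subsets }B\subseteq A\}.$$ The algorithm GREEDY-RANDOM-SAMPLING, on input an $s$-uniform hypergraph $G$ on $[n]$, maintains a set $S$ (initially empty) of $k$-subsets of $[n]$ and, for $T$ independent iterations, does the following. (1) Sample distinct starting vertices $v_1,\dots,v_{s-1}$ uniformly at random, and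 then sample $v_s,v_{s+1},\dots,v_k$ iteratively, where $v_{i+1}$ is chosen uniformly at random from $\mathrm{CN}_G(\{v_1,\dots,v_i\})$ if this set is nonempty (otherwise the iteration ends without choosing $k$ vertices). (2) If $k$ vertices $v_1,\dots,v_k$ are chosen, add $\{v_1,\dots,v_k\}$ to $S$ if it is not already in $S$. The notation $n^{ -\omega(1)}$ denotes a quantity decaying faster than any fixed polynomial in $1/n$. -}

module Defs where

open import Algebra.Bundles using (CommutativeRing; Semiring)
import Algebra.Definitions.RawSemiring as RawSemiringDefs
import Algebra.Properties.Ring as RingProperties
open import Data.Bool.Base using (if_then_else_)
open import Data.Empty using (⊥-elim)
open import Data.Fin.Base using (Fin)
import Data.Fin.Properties as Fin
open import Data.Fin.Subset using (Subset; inside; outside; ∣_∣; ⁅_⁆; ⋃; _∪_)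
  renaming (_∈_ to _∈ˢ_; _∉_ to _∉ˢ_; _⊆_ to _⊆ˢ_)
open import Data.Fin.Subset.Properties using (anySubset?)
  renaming (_∈?_ to _∈ˢ?_; _⊆?_ to _⊆ˢ?_)
import Data.Bool.Properties as Bool
open import Data.List.Base
  using (List; []; _∷_; _++_; map; concatMap; filter; foldr; length; allFin)
open import Data.List.Relation.Unary.Unique.DecPropositional using (unique?)
import Data.List.Membership.DecPropositional as DecMembership
open import Data.Maybe.Base using (Maybe; just; nothing)
open import Data.Nat.Base as ℕ
  using (ℕ; zero; suc; NonZero; NonTrivial; nonTrivial⇒nonZero; pred; _∸_)
import Data.Nat.Properties as ℕ
open import Data.Nat.Combinatorics using (_C_)
open import Data.Product.Base using (_×_; _,_; ∃-syntax)
open import Data.Sum.Base using (inj₁; inj₂)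
import Data.Vec.Base as Vec
import Data.Vec.Properties as Vec
open import Function.Base using (_∘_)
open import Level using (Level; _⊔_) renaming (suc to lsuc)
open import Relation.Binary.Core using (Rel)
open import Relation.Binary.Definitions using (Cotransitive; DecidableEquality)
open import Relation.Binary.PropositionalEquality.Core using (_≡_)
open import Relation.Binary.Structures using (IsStrictPartialOrder)
open import Relation.Nullary.Decidable
  using (Dec; yes; no; does; ¬?; _×-dec_; _→-dec_; map′; decidable-stable)
open import Relation.Nullary.Negation using (¬_)
open import Relation.Unary using (Pred; Decidable)

-- agda-stdlib has no real numbers, so they are described axiomatically: a
-- Cauchy-complete Archimedean ordered field with its exponential function.
-- The axioms are in the constructive form (cotransitivity and tightness
-- in place of trichotomy); classically they determine ℝ up to a unique
-- isomorphism.  `exp` is the natural exponential: it is the only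
-- homomorphism from (ℝ, +) to (ℝ, ·) with 1 + x ≤ exp x.

record RealNumbers c ℓ₁ ℓ₂ : Set (lsuc (c ⊔ ℓ₁ ⊔ ℓ₂)) where
  infix 4 _<_ _≤_
  field
    commutativeRing : CommutativeRing c ℓ₁

  open CommutativeRing commutativeRing public
  open RawSemiringDefs
    (Semiring.rawSemiring (CommutativeRing.semiring commutativeRing)) public
    using (_^_) renaming (_×_ to _·_)

  fromℕ : ℕ → Carrier
  fromℕ n = n · 1#

  field
    _<_ : Rel Carrier ℓ₂
    <-isStrictPartialOrder : IsStrictPartialOrder _≈_ _<_
    <-cotrans  : Cotransitive _<_
    <-tight    : ∀ {x y} → ¬ (x < y) → ¬ (y < x) → x ≈ y

    0<1        : 0# < 1#
    +-monoˡ-<  : ∀ z {x y} → x < y → x + z < y + z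
    *-pos      : ∀ {x y} → 0# < x → 0# < y → 0# < x * y

    recip      : ∀ x → 0# < x → Carrier
    *-recip    : ∀ x (x>0 : 0# < x) → x * recip x x>0 ≈ 1#
    recip-pos  : ∀ x (x>0 : 0# < x) → 0# < recip x x>0

  _≤_ : Rel Carrier ℓ₂
  x ≤ y = ¬ (y < x)

  Within : Carrier → Rel Carrier ℓ₂
  Within δ x y = (x < y + δ) × (y < x + δ)

  field
    archimedean : ∀ x → ∃[ n ] x < fromℕ n
    complete    : (u : ℕ → Carrier) →
      (∀ δ → 0# < δ →
        ∃[ N ] (∀ m n → N ℕ.≤ m → N ℕ.≤ n → Within δ (u m) (u n))) →
      ∃[ l ] (∀ δ → 0# < δ → ∃[ N ] (∀ n → N ℕ.≤ n → Within δ (u n) l))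

    exp       : Carrier → Carrier
    exp-cong  : ∀ {x y} → x ≈ y → exp x ≈ exp y
    exp-0     : exp 0# ≈ 1#
    exp-+     : ∀ x y → exp (x + y) ≈ exp x * exp y
    1+x≤exp   : ∀ x → 1# + x ≤ exp x

    log       : ∀ x → 0# < x → Carrier
    exp-log   : ∀ x (x>0 : 0# < x) → exp (log x x>0) ≈ x

  -- pow x x>0 y is x ^ y for a real exponent y.
  pow : ∀ x → 0# < x → Carrier → Carrier
  pow x x>0 y = exp (y * log x x>0)

  open IsStrictPartialOrder <-isStrictPartialOrder public
    using (<-respʳ-≈; <-respˡ-≈) renaming (irrefl to <-irrefl; trans to <-trans)

  private
    open RingProperties ring using (-‿distribʳ-*)

    shift : ∀ x z → (x + z) + (- z) ≈ x
    shift x z = trans (+-assoc x z (- z))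
                (trans (+-cong refl (-‿inverseʳ z)) (+-identityʳ x))

    +-pos : ∀ {x y} → 0# < x → 0# < y → 0# < x + y
    +-pos {x} {y} x>0 y>0 =
      <-trans y>0 (<-respˡ-≈ (+-identityˡ y) (+-monoˡ-< y x>0))

    <⇒diff : ∀ {x y} → x < y → 0# < y - x
    <⇒diff {x} x<y = <-respˡ-≈ (-‿inverseʳ x) (+-monoˡ-< (- x) x<y)

    diff⇒< : ∀ {x y} → 0# < y - x → x < y
    diff⇒< {x} {y} d =
      <-respʳ-≈ (trans (+-assoc y (- x) x)
                (trans (+-cong refl (-‿inverseˡ x)) (+-identityʳ y)))
      (<-respˡ-≈ (+-identityˡ x) (+-monoˡ-< x d))

    cancel-pos : ∀ x y → 0# < x → 0# < x * y → 0# < y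
    cancel-pos x y x>0 xy>0 = <-respʳ-≈ eq (*-pos (recip-pos x x>0) xy>0)
      where
      r = recip x x>0
      eq : r * (x * y) ≈ y
      eq = trans (sym (*-assoc r x y))
           (trans (*-cong (trans (*-comm r x) (*-recip x x>0)) refl)
                  (*-identityˡ y))

    *-distribˡ-- : ∀ x y z → x * y - x * z ≈ x * (y - z)
    *-distribˡ-- x y z =
      trans (+-cong refl (-‿distribʳ-* x z)) (sym (distribˡ x y (- z)))

  fromℕ-pos : ∀ n → .{{NonZero n}} → 0# < fromℕ n
  fromℕ-pos (suc zero)      = <-respʳ-≈ (sym (+-identityʳ 1#)) 0<1
  fromℕ-pos (suc n@(suc _)) = +-pos 0<1 (fromℕ-pos n)

  log-pos : ∀ x (x>0 : 0# < x) → 1# < x → 0# < log x x>0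
  log-pos x x>0 1<x = cancel-pos x L x>0 xL>0
    where
    L = log x x>0

    x*exp[-L]≈1 : x * exp (- L) ≈ 1#
    x*exp[-L]≈1 =
      trans (*-cong (sym (exp-log x x>0)) refl)
      (trans (sym (exp-+ L (- L)))
      (trans (exp-cong (-‿inverseʳ L)) exp-0))

    upper : x * (1# - L) ≤ 1#
    upper 1<xl = 1+x≤exp (- L) (diff⇒< (cancel-pos x _ x>0
      (<-respʳ-≈ (*-distribˡ-- x _ _)
        (<⇒diff (<-respˡ-≈ (sym x*exp[-L]≈1) 1<xl)))))

    x-xL : x * (1# - L) ≈ x - x * L
    x-xL = trans (sym (*-distribˡ-- x 1# L)) (+-cong (*-identityʳ x) refl)

    xL>0 : 0# < x * L
    xL>0 with <-cotrans 1<x (x * (1# - L))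
    ... | inj₁ absurd = ⊥-elim (upper absurd)
    ... | inj₂ less   =
      <-respʳ-≈ (trans (+-cong (+-comm x _) refl) (shift _ x))
      (<-respˡ-≈ (-‿inverseʳ x)
        (+-monoˡ-< (- x)
          (<-respʳ-≈ refl
            (<-respˡ-≈
              (trans (+-assoc x _ _)
                (trans (+-cong refl (-‿inverseˡ (x * L))) (+-identityʳ x)))
              (+-monoˡ-< (x * L) (<-respˡ-≈ x-xL less))))))

  -- For n ≥ 2 both n and log n are positive, hence n ^ y and (log n) ^ y
  -- are defined for every real y.

  module _ (n : ℕ) .{{_ : NonTrivial n}} where

    fromℕ-pos′ : 0# < fromℕ n
    fromℕ-pos′ = fromℕ-pos n {{nonTrivial⇒nonZero n}}

    logℕ : Carrier
    logℕ = log (fromℕ n) fromℕ-pos′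

  1<fromℕ : ∀ n → .{{NonTrivial n}} → 1# < fromℕ n
  1<fromℕ (suc n@(suc _)) =
    <-respʳ-≈ (+-comm (fromℕ n) 1#)
    (<-respˡ-≈ (+-identityˡ 1#) (+-monoˡ-< 1# (fromℕ-pos n)))

  logℕ-pos : ∀ n → .{{_ : NonTrivial n}} → 0# < logℕ n
  logℕ-pos n = log-pos (fromℕ n) (fromℕ-pos′ n) (1<fromℕ n)

allSubset? : ∀ {n ℓ} {P : Pred (Subset n) ℓ} →
             Decidable P → Dec (∀ p → P p)
allSubset? P? = map′
  (λ ¬∃ p → decidable-stable (P? p) (λ ¬Pp → ¬∃ (p , ¬Pp)))
  (λ all (p , ¬Pp) → ¬Pp (all p))
  (¬? (anySubset? (¬? ∘ P?)))

_≟ˢ_ : ∀ {n} → DecidableEquality (Subset n)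
_≟ˢ_ = Vec.≡-dec Bool._≟_

module _ {n : ℕ} where
  open DecMembership (_≟ˢ_ {n}) public using (_∈_; _∈?_)

allSubsets : ∀ n → List (Subset n)
allSubsets zero    = Vec.[] ∷ []
allSubsets (suc n) = map (inside Vec.∷_) (allSubsets n)
                  ++ map (outside Vec.∷_) (allSubsets n)

subsetsOfSize : ∀ n → ℕ → List (Subset n)
subsetsOfSize n k = filter (λ p → ∣ p ∣ ℕ.≟ k) (allSubsets n)

-- A hypergraph on the vertex set Fin n, given by the list of its edges.
Hypergraph : ℕ → Set
Hypergraph n = List (Subset n)

module _ {n : ℕ} (s : ℕ) (G : Hypergraph n) where

  IsClique : ℕ → Subset n → Set
  IsClique k W = ∣ W ∣ ≡ k × (∀ B → ∣ B ∣ ≡ s → B ⊆ˢ W → B ∈ G)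

  isClique? : ∀ k → Decidable (IsClique k)
  isClique? k W = (∣ W ∣ ℕ.≟ k) ×-dec
    allSubset? (λ B → (∣ B ∣ ℕ.≟ s) →-dec ((B ⊆ˢ? W) →-dec (B ∈? G)))

  -- The condition suc ∣ B ∣ ≡ s says that B is an (s − 1)-subset.
  IsCommonNeighbour : Subset n → Fin n → Set
  IsCommonNeighbour A v =
    v ∉ˢ A × (∀ B → suc ∣ B ∣ ≡ s → B ⊆ˢ A → B ∪ ⁅ v ⁆ ∈ G)

  isCommonNeighbour? : ∀ A → Decidable (IsCommonNeighbour A)
  isCommonNeighbour? A v = ¬? (v ∈ˢ? A) ×-dec
    allSubset? (λ B → (suc ∣ B ∣ ℕ.≟ s) →-dec
                      ((B ⊆ˢ? A) →-dec ((B ∪ ⁅ v ⁆) ∈? G)))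

  CN : Subset n → List (Fin n)
  CN A = filter (isCommonNeighbour? A) (allFin n)

  -- The finite set of subsets listed by S is cl_k(G).
  IsCliqueSet : ℕ → List (Subset n) → Set
  IsCliqueSet k S =
    ∀ W → (W ∈ S → IsClique k W) × (IsClique k W → W ∈ S)

  isCliqueSet? : ∀ k → Decidable (IsCliqueSet k)
  isCliqueSet? k S = allSubset? (λ W →
    ((W ∈? S) →-dec isClique? k W) ×-dec (isClique? k W →-dec (W ∈? S)))

tuples : ∀ {a} {A : Set a} → ℕ → List A → List (List A)
tuples zero    xs = [] ∷ []
tuples (suc m) xs = concatMap (λ x → map (x ∷_) (tuples m xs)) xs

distinctTuples : ∀ n → ℕ → List (List (Fin n))
distinctTuples n m = filter (unique? Fin._≟_) (tuples m (allFin n))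

toSubset : ∀ {n} → List (Fin n) → Subset n
toSubset vs = ⋃ (map ⁅_⁆ vs)

module GreedyRandomSampling {c ℓ₁ ℓ₂} (R : RealNumbers c ℓ₁ ℓ₂) where
  open RealNumbers R

  -- Finitely supported distributions, as lists of weighted outcomes; the
  -- same outcome may be listed several times, and its weights then add up.

  Dist : ∀ {a} → Set a → Set (c ⊔ a)
  Dist A = List (Carrier × A)

  private
    variable
      a b p : Level
      A : Set a
      B : Set b

  infixl 1 _>>=_

  return : A → Dist A
  return x = (1# , x) ∷ []

  _>>=_ : Dist A → (A → Dist B) → Dist B
  D >>= f = concatMap (λ (w , x) → map (λ (v , y) → w * v , y) (f x)) D

  Pr : {P : Pred A p} → Dist A → Decidable P → Carrier
  Pr D P? = foldr (λ (w , x) q → (if does (P? x) then w else 0#) + q) 0# D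

  -- A uniformly random entry of the list, or nothing if it is empty.
  uniform : List A → Dist (Maybe A)
  uniform []          = return nothing
  uniform xs@(_ ∷ ys) = map (λ x → weight , just x) xs
    where weight = recip (fromℕ (suc (length ys))) (fromℕ-pos (suc (length ys)))

  -- Each entry of the list is kept independently with probability q.
  randomSublist : Carrier → List A → Dist (List A)
  randomSublist q []       = return []
  randomSublist q (x ∷ xs) = randomSublist q xs >>= λ ys →
    (q , x ∷ ys) ∷ (1# - q , ys) ∷ []

  𝔾 : ∀ n → Carrier → ℕ → Dist (Hypergraph n)
  𝔾 n q s = randomSublist q (subsetsOfSize n s)

  module _ {n : ℕ} (k s : ℕ) (G : Hypergraph n) where

    extend : ℕ → List (Fin n) → Dist (Maybe (List (Fin n)))
    extend zero    vs = return (just vs)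
    extend (suc j) vs = uniform (CN s G (toSubset vs)) >>= λ where
      nothing  → return nothing
      (just v) → extend j (v ∷ vs)

    sampleVertices : Dist (Maybe (List (Fin n)))
    sampleVertices = uniform (distinctTuples n (pred s)) >>= λ where
      nothing   → return nothing
      (just vs) → extend (k ∸ pred s) vs

    addResult : Maybe (List (Fin n)) → List (Subset n) → List (Subset n)
    addResult nothing   S = S
    addResult (just vs) S with toSubset vs ∈? S
    ... | yes _ = S
    ... | no  _ = toSubset vs ∷ S

    iterate : ℕ → List (Subset n) → Dist (List (Subset n))
    iterate zero    S = return S
    iterate (suc t) S = sampleVertices >>= λ r → iterate t (addResult r S)

    greedyRandomSampling : ℕ → Dist (List (Subset n))
    greedyRandomSampling T = iterate T []

  -- The probability, over G ~ G(n, q, s) and the random bits of the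
  -- algorithm, that T iterations end with S = cl_k(G).
  successProbability : (n k s : ℕ) → Carrier → ℕ → Carrier
  successProbability n k s q T = Pr experiment
      (λ (G , S) → isCliqueSet? s G k S)
    where
    experiment : Dist (Hypergraph n × List (Subset n))
    experiment = 𝔾 n q s >>= λ G →
                 greedyRandomSampling k s G T >>= λ S →
                 return (G , S)

  -- Only n ≥ 2 is considered, which does not affect the meaning of
  -- "for all sufficiently large n".
  Eventually : ∀ {ℓ} → (∀ n → .{{NonTrivial n}} → Set ℓ) → Set ℓ
  Eventually P = ∃[ N ] (∀ n → .{{_ : NonTrivial n}} → N ℕ.≤ n → P n)

  -- f n = Θ(n ^ y)
  IsΘPow : (ℕ → Carrier) → Carrier → Set (c ⊔ ℓ₂)
  IsΘPow f y = ∃[ a ] ∃[ b ] (0# < a) × (0# < b) × Eventually (λ n →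
    (a * pow (fromℕ n) (fromℕ-pos′ n) y ≤ f n) ×
    (f n ≤ b * pow (fromℕ n) (fromℕ-pos′ n) y))

  -- f n = n ^ (− ω(1)), for a nonnegative quantity f n
  IsSuperpolynomiallySmall : (ℕ → Carrier) → Set ℓ₂
  IsSuperpolynomiallySmall f = ∀ (m : ℕ) → Eventually (λ n →
    (0# ≤ f n) × (f n ≤ pow (fromℕ n) (fromℕ-pos′ n) (- fromℕ m)))

  IsThreshold : Carrier → ℕ → ℕ → Set ℓ₂
  IsThreshold α s τ =
    (α * fromℕ (τ C pred s) < 1#) ×
    (∀ t → α * fromℕ (t C pred s) < 1# → t ℕ.≤ τ)

  EnoughIterations : (n : ℕ) → .{{NonTrivial n}} →
    (k s τ : ℕ) → (q ε : Carrier) → ℕ → Set ℓ₂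
  EnoughIterations n k s τ q ε T =
    (suc τ ℕ.≤ k →
      fromℕ 2 * fromℕ n ^ suc τ * q ^ (suc τ C s)
        * pow (fromℕ 3 * logℕ n) (*-pos (fromℕ-pos 3) (logℕ-pos n))
              (fromℕ (k ∸ τ) * (1# + ε))
      ≤ fromℕ T) ×
    (k ℕ.< suc τ →
      fromℕ 2 * fromℕ n ^ k * q ^ (k C s)
        * pow (logℕ n) (logℕ-pos n) (1# + ε)
      ≤ fromℕ T)

module Submission where

-- Fix a threshold m(i) for the number of common neighbours of an i-set: (1 + δ) n q^C(i, s−1)
-- for i ≤ τ, and 3 log n for i > τ.  If no threshold is exceeded, then one iteration,
-- following any fixed clique W, hits W with probability at least 1/M, where
-- M = n^(s−1) m(s−1) ⋯ m(k−1).  Since T ≥ M (log n)^(1+ε), all n^k potential cliques are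
-- found except with superpolynomially small probability.
--
-- The size X of a common neighbourhood is a sum of indicators of disjoint sets of edges, so
-- E exp(θX) ≤ exp(n (exp θ − 1) q^C(i, s−1)).  Instead of conditioning on the event X ≤ m,
-- which is undecidable for a real m, the failure probability of the algorithm on a fixed
-- hypergraph is bounded by the failure probability when no threshold is exceeded plus the
-- sum of all exp(θ(X − m)).  This inequality between numbers is a negation, so it may be
-- proved by contradiction, and its expectation is the sum of the Chernoff bounds.

-- Throughout, `r` is s - 1. The condition on T has one logarithmic factor to spare: the thresholds
-- above τ use up (3 log n)^(k-τ-1), so the power (3 log n)^((k-τ)(1+ε)) leaves at least (3 log
-- n)^(1+ε), which exceeds K log n for every constant K once n is large. A fixed clique is then
-- missed with probability at most exp(-K log n) = n^(-K), and every tail bound is calibrated to the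
-- same n^(-K). That K may be arbitrary is due to the two halves of the definition of τ. Since α
-- C(τ, s-1) < 1, the expected number of common neighbours of a set of size at most τ grows like a
-- power of n, so even a small constant δ gives tails below n^(-K). Since α C(τ+1, s-1) ≥ 1, that
-- expectation stays bounded above size τ; a constant tilt K multiplies it only by a constant, while
-- the threshold contributes -3K log n to the exponent. The constant δ is the only loss against the
-- expected counts, and it is taken so small that its total effect is the factor 2 in the bound on
-- T.

open import Defs
open import Algebra.Bundles using (CommutativeRing)
import Algebra.Properties.AbelianGroup as AbelianGroupProperties
import Algebra.Properties.CommutativeSemiring.Exp as CExp
import Algebra.Properties.Ring as RingProperties
import Algebra.Properties.Semiring.Exp as Exp
import Algebra.Properties.Semiring.Mult as Mult
import Algebra.Properties.Semiring.Mult.TCOptimised as Mult′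
import Algebra.Solver.Ring as RingSolver
import Algebra.Solver.Ring.AlmostCommutativeRing as ACR
open import Data.Bool.Base using (true; false; if_then_else_)
open import Data.Empty using (⊥-elim)
open import Data.Fin.Base using (Fin; zero; suc)
import Data.Fin.Properties as Fin
open import Data.Fin.Subset using (Subset; inside; outside; ⊤; ∣_∣; ⁅_⁆; _∪_)
  renaming (_∈_ to _∈ˢ_; _∉_ to _∉ˢ_; _⊆_ to _⊆ˢ_)
import Data.Fin.Subset.Properties as Subset
import Data.Integer.Base as ℤ
import Data.Integer.Properties as ℤ
open import Data.List.Base
  using (List; []; _∷_; _++_; map; concatMap; filter; length; allFin; upTo)
open import Data.List.Membership.Propositional using () renaming (_∈_ to _∈ˡ_; _∉_ to _∉ˡ_)
import Data.List.Membership.Propositional.Properties as ∈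
import Data.List.Properties as List
open import Data.List.Relation.Binary.Permutation.Propositional as ↭ using (_↭_)
import Data.List.Relation.Binary.Permutation.Propositional.Properties as ↭
open import Data.List.Relation.Unary.All as All using (All; []; _∷_)
import Data.List.Relation.Unary.All.Properties as All
open import Data.List.Relation.Unary.AllPairs as AllPairs using ([]; _∷_)
import Data.List.Relation.Unary.AllPairs.Properties as AllPairs
open import Data.List.Relation.Unary.Any using (here; there)
open import Data.List.Relation.Unary.Unique.DecPropositional using (unique?)
open import Data.List.Relation.Unary.Unique.Propositional using (Unique)
import Data.List.Relation.Unary.Unique.Propositional.Properties as Unique
open import Data.Maybe.Base as Maybe using (Maybe; just; nothing)
open import Data.Nat.Base as ℕ using (ℕ; zero; suc; _∸_; NonZero; NonTrivial)
open import Data.Nat.Combinatorics using (_C_; nCk+nC[k+1]≡[n+1]C[k+1]; nCn≡1; k>n⇒nCk≡0)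
import Data.Nat.Properties as ℕ
open import Data.Product.Base using (_×_; _,_; ∃-syntax; proj₁; proj₂)
open import Data.Sum.Base using (inj₁; inj₂; [_,_]′)
open import Data.Vec.Base using ([]; _∷_; here; there)
import Data.Vec.Properties as Vec
open import Function.Base using (_∘_; const)
open import Level using (Level)
import Relation.Binary.Reasoning.Base.Triple as TripleReasoning
open import Relation.Binary.PropositionalEquality as ≡ using (_≡_; _≢_)
open import Relation.Binary.Structures using (IsPreorder)
open import Relation.Nullary.Decidable
  using (Dec; yes; no; does; ¬?; _×-dec_; dec-true; dec-false; dec⇒maybe; decidable-stable)
open import Relation.Nullary.Negation using (¬_; contradiction)
open import Relation.Unary using (Pred; Decidable; U)

-- The coefficients are integers rather than elements of the ring, so that subtractions cancel.
module IntegerRingSolver {c ℓ} (CR : CommutativeRing c ℓ) where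
  open CommutativeRing CR
  open import Data.Integer.Base using (ℤ; +_; -[1+_]; _⊖_)
  open Mult′ semiring renaming (_×_ to _·_)
  open RingProperties ring
  open AbelianGroupProperties +-abelianGroup using (⁻¹-∙-comm)

  -- With the optimised multiples the coefficient 1 denotes `1#` itself and not `1# + 0#`, so `:1`
  -- can stand for the unit in goals up to definitional equality.
  ⟦_⟧ : ℤ → Carrier
  ⟦ + n ⟧      = n · 1#
  ⟦ -[1+ n ] ⟧ = - (suc n · 1#)

  ⟦⟧-neg : ∀ i → ⟦ ℤ.- i ⟧ ≈ - ⟦ i ⟧
  ⟦⟧-neg (+ zero)   = sym -0#≈0#
  ⟦⟧-neg (+ suc n)  = refl
  ⟦⟧-neg (-[1+ n ]) = sym (-‿involutive _)

  ⟦⟧-⊖ : ∀ m n → ⟦ m ⊖ n ⟧ ≈ m · 1# - n · 1#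
  ⟦⟧-⊖ zero zero = sym (-‿inverseʳ 0#)
  ⟦⟧-⊖ zero (suc n) = sym (+-identityˡ _)
  ⟦⟧-⊖ (suc m) zero = sym (trans (+-congˡ -0#≈0#) (+-identityʳ _))
  ⟦⟧-⊖ (suc m) (suc n) = trans (reflexive (≡.cong ⟦_⟧ (ℤ.[1+m]⊖[1+n]≡m⊖n m n)))
    (trans (⟦⟧-⊖ m n) (sym (trans (+-cong (1+× m 1#) (-‿cong (1+× n 1#)))
      (cancel 1# (m · 1#) (n · 1#)))))
    where
    cancel : ∀ x y z → (x + y) - (x + z) ≈ y - z
    cancel x y z = trans (+-cong (+-comm x y) (sym (⁻¹-∙-comm x z)))
      (trans (+-assoc y x _) (+-congˡ (trans (sym (+-assoc x (- x) (- z)))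
        (trans (+-congʳ (-‿inverseʳ x)) (+-identityˡ _)))))

  ⟦⟧-+ : ∀ i j → ⟦ i ℤ.+ j ⟧ ≈ ⟦ i ⟧ + ⟦ j ⟧
  ⟦⟧-+ (+ m) (+ n) = ×-homo-+ 1# m n
  ⟦⟧-+ (+ m) (-[1+ n ]) = ⟦⟧-⊖ m (suc n)
  ⟦⟧-+ (-[1+ m ]) (+ n) = trans (⟦⟧-⊖ n (suc m)) (+-comm _ _)
  ⟦⟧-+ (-[1+ m ]) (-[1+ n ]) = trans
    (-‿cong (trans (reflexive (≡.cong (λ a → suc a · 1#) (≡.sym (ℕ.+-suc m n))))
                   (×-homo-+ 1# (suc m) (suc n))))
    (sym (⁻¹-∙-comm _ _))

  ⟦⟧-* : ∀ i j → ⟦ i ℤ.* j ⟧ ≈ ⟦ i ⟧ * ⟦ j ⟧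
  ⟦⟧-* (+ m) (+ n) =
    trans (reflexive (≡.cong ⟦_⟧ (≡.sym (ℤ.pos-* m n)))) (×1-homo-* m n)
  ⟦⟧-* i@(+ m) (-[1+ n ]) =
    trans (reflexive (≡.cong ⟦_⟧ (≡.sym (ℤ.neg-distribʳ-* i (+ suc n)))))
    (trans (⟦⟧-neg (i ℤ.* + suc n))
    (trans (-‿cong (⟦⟧-* i (+ suc n))) (-‿distribʳ-* _ _)))
  ⟦⟧-* (-[1+ m ]) j@(+ n) =
    trans (reflexive (≡.cong ⟦_⟧ (≡.sym (ℤ.neg-distribˡ-* (+ suc m) j))))
    (trans (⟦⟧-neg (+ suc m ℤ.* j))
    (trans (-‿cong (⟦⟧-* (+ suc m) j)) (-‿distribˡ-* _ _)))
  ⟦⟧-* (-[1+ m ]) (-[1+ n ]) =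
    trans (reflexive (≡.cong ⟦_⟧ (ℤ.pos-* (suc m) (suc n))))
    (trans (×1-homo-* (suc m) (suc n))
    (sym (trans (sym (-‿distribˡ-* _ _)) (trans (-‿cong (sym (-‿distribʳ-* _ _)))
      (-‿involutive _)))))

  private
    target = ACR.fromCommutativeRing CR

    morphism : ℤ.+-*-rawRing ACR.-Raw-AlmostCommutative⟶ target
    morphism = record
      { ⟦_⟧ = ⟦_⟧ ; +-homo = ⟦⟧-+ ; *-homo = ⟦⟧-* ; -‿homo = ⟦⟧-neg
      ; 0-homo = refl ; 1-homo = refl }

  open RingSolver ℤ.+-*-rawRing target morphism
    (λ i j → Maybe.map (λ i≡j → reflexive (≡.cong ⟦_⟧ i≡j)) (dec⇒maybe (i ℤ.≟ j)))
    public using (solve; Polynomial; con; _:+_; _:*_; _:-_; :-_; _:=_)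

  :0 :1 : ∀ {n} → Polynomial n
  :0 = con (+ 0)
  :1 = con (+ 1)

-- Real numbers

module RealFacts {c ℓ₁ ℓ₂} (R : RealNumbers c ℓ₁ ℓ₂) where
  open RealNumbers R
  open IntegerRingSolver commutativeRing using (solve; :0; :1; _:+_; _:*_; _:-_; :-_; _:=_)
  open Exp semiring using (^-congˡ; ^-homo-*) public
  open CExp commutativeSemiring using (^-distrib-*) public

  private
    variable
      w x y z : Carrier

  ≤-refl : x ≤ x
  ≤-refl = <-irrefl refl

  ≤-reflexive : x ≈ y → x ≤ y
  ≤-reflexive x≈y y<x = <-irrefl (sym x≈y) y<x

  ≤-trans : x ≤ y → y ≤ z → x ≤ z
  ≤-trans {y = y} x≤y y≤z z<x = [ y≤z , x≤y ]′ (<-cotrans z<x y)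

  <-≤-trans : x < y → y ≤ z → x < z
  <-≤-trans {z = z} x<y y≤z = [ (λ x<z → x<z) , (λ z<y → ⊥-elim (y≤z z<y)) ]′ (<-cotrans x<y z)

  ≤-<-trans : x ≤ y → y < z → x < z
  ≤-<-trans {x = x} x≤y y<z = [ (λ y<x → ⊥-elim (x≤y y<x)) , (λ x<z → x<z) ]′ (<-cotrans y<z x)

  <⇒≤ : x < y → x ≤ y
  <⇒≤ x<y y<x = <-irrefl refl (<-trans x<y y<x)

  ≤-isPreorder : IsPreorder _≈_ _≤_
  ≤-isPreorder = record
    { isEquivalence = isEquivalence ; reflexive = ≤-reflexive ; trans = ≤-trans }

  module ≤-Reasoning = TripleReasoning ≤-isPreorder
    (λ x<y y<x → <-irrefl refl (<-trans x<y y<x)) <-trans (<-respʳ-≈ , <-respˡ-≈)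
    <⇒≤ <-≤-trans ≤-<-trans

  open ≤-Reasoning

  ≤-resp-≈ : x ≈ y → w ≈ z → x ≤ w → y ≤ z
  ≤-resp-≈ x≈y w≈z x≤w z<y = x≤w (<-respʳ-≈ (sym x≈y) (<-respˡ-≈ (sym w≈z) z<y))

  +-monoˡ-≤ : ∀ z → x ≤ y → x + z ≤ y + z
  +-monoˡ-≤ {x} {y} z x≤y lt = x≤y (<-respʳ-≈ (cancel x z) (<-respˡ-≈ (cancel y z)
    (+-monoˡ-< (- z) lt)))
    where
    cancel : ∀ a b → a + b - b ≈ a
    cancel = solve 2 (λ a b → a :+ b :- b := a) refl

  +-monoʳ-≤ : ∀ z → x ≤ y → z + x ≤ z + y
  +-monoʳ-≤ z x≤y = ≤-resp-≈ (+-comm _ z) (+-comm _ z) (+-monoˡ-≤ z x≤y)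

  +-mono-≤ : w ≤ x → y ≤ z → w + y ≤ x + z
  +-mono-≤ {x = x} {y = y} w≤x y≤z = ≤-trans (+-monoˡ-≤ y w≤x) (+-monoʳ-≤ x y≤z)

  +-nonneg : 0# ≤ x → 0# ≤ y → 0# ≤ x + y
  +-nonneg x≥0 y≥0 = ≤-trans (≤-reflexive (sym (+-identityˡ 0#))) (+-mono-≤ x≥0 y≥0)

  x≤x+y : 0# ≤ y → x ≤ x + y
  x≤x+y {x = x} y≥0 = ≤-trans (≤-reflexive (sym (+-identityʳ x))) (+-monoʳ-≤ x y≥0)

  x≤y+x : 0# ≤ y → x ≤ y + x
  x≤y+x y≥0 = ≤-trans (x≤x+y y≥0) (≤-reflexive (+-comm _ _))

  x≤y⇒0≤y-x : x ≤ y → 0# ≤ y - x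
  x≤y⇒0≤y-x {x} x≤y = ≤-resp-≈ (-‿inverseʳ x) refl (+-monoˡ-≤ (- x) x≤y)

  0≤y-x⇒x≤y : 0# ≤ y - x → x ≤ y
  0≤y-x⇒x≤y {y} {x} d = ≤-resp-≈ (+-identityˡ x)
    (solve 2 (λ a b → b :- a :+ a := b) refl x y) (+-monoˡ-≤ x d)

  x<y⇒0<y-x : x < y → 0# < y - x
  x<y⇒0<y-x {x} x<y = <-respˡ-≈ (-‿inverseʳ x) (+-monoˡ-< (- x) x<y)

  neg-mono-≤ : x ≤ y → - y ≤ - x
  neg-mono-≤ {x} {y} x≤y = 0≤y-x⇒x≤y (≤-resp-≈ refl
    (solve 2 (λ a b → b :- a := :- a :- :- b) refl x y) (x≤y⇒0≤y-x x≤y))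

  -- A nonnegative number is not not zero or positive, and ≤ is a negation.
  *-nonneg : 0# ≤ x → 0# ≤ y → 0# ≤ x * y
  *-nonneg {x} {y} x≥0 y≥0 xy<0 = ¬¬pos y≥0 (λ y≈0 → xy≈0 (trans (*-congˡ y≈0) (zeroʳ x)))
    λ y>0 → ¬¬pos x≥0 (λ x≈0 → xy≈0 (trans (*-congʳ x≈0) (zeroˡ y)))
    λ x>0 → <⇒≤ (*-pos x>0 y>0) xy<0
    where
    xy≈0 : ¬ (x * y ≈ 0#)
    xy≈0 eq = <-irrefl eq xy<0

    ¬¬pos : 0# ≤ z → ¬ (z ≈ 0#) → ¬ ¬ (0# < z)
    ¬¬pos z≥0 z≉0 z≯0 = z≉0 (<-tight z≥0 z≯0)

  -- Either sign of `x` would make the square positive, so a negative square forces `x ≈ 0#` by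
  -- tightness, and then the square is zero. The sign of `x` is never decided.
  square-nonneg : ∀ x → 0# ≤ x * x
  square-nonneg x xx<0 = xx≉0 (<-tight x≮0 x≯0)
    where
    xx≉0 : ¬ (x ≈ 0#)
    xx≉0 x≈0 = <-irrefl (trans (*-congʳ x≈0) (zeroˡ x)) xx<0

    x≯0 : ¬ (0# < x)
    x≯0 x>0 = <⇒≤ (*-pos x>0 x>0) xx<0

    x≮0 : ¬ (x < 0#)
    x≮0 x<0 = <⇒≤ (<-respʳ-≈ (solve 1 (λ a → (:0 :- a) :* (:0 :- a) := a :* a) refl x)
      (*-pos (x<y⇒0<y-x x<0) (x<y⇒0<y-x x<0))) xx<0

  *-monoˡ-≤ : 0# ≤ z → x ≤ y → z * x ≤ z * y
  *-monoˡ-≤ {z} {x} {y} z≥0 x≤y = 0≤y-x⇒x≤y (≤-resp-≈ refl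
    (solve 3 (λ a b d → d :* (b :- a) := d :* b :- d :* a) refl x y z)
    (*-nonneg z≥0 (x≤y⇒0≤y-x x≤y)))

  *-monoʳ-≤ : 0# ≤ z → x ≤ y → x * z ≤ y * z
  *-monoʳ-≤ z≥0 x≤y = ≤-resp-≈ (*-comm _ _) (*-comm _ _) (*-monoˡ-≤ z≥0 x≤y)

  *-mono-≤ : 0# ≤ w → w ≤ x → 0# ≤ y → y ≤ z → w * y ≤ x * z
  *-mono-≤ w≥0 w≤x y≥0 y≤z =
    ≤-trans (*-monoʳ-≤ y≥0 w≤x) (*-monoˡ-≤ (≤-trans w≥0 w≤x) y≤z)

  0≤1 : 0# ≤ 1#
  0≤1 = <⇒≤ 0<1

  *-≥1 : 1# ≤ x → 1# ≤ y → 1# ≤ x * y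
  *-≥1 x≥1 y≥1 = ≤-trans (≤-reflexive (sym (*-identityˡ 1#))) (*-mono-≤ 0≤1 x≥1 0≤1 y≥1)

  ^-nonneg : 0# ≤ x → ∀ n → 0# ≤ x ^ n
  ^-nonneg x≥0 zero    = 0≤1
  ^-nonneg x≥0 (suc n) = *-nonneg x≥0 (^-nonneg x≥0 n)

  ^-pos : 0# < x → ∀ n → 0# < x ^ n
  ^-pos x>0 zero    = 0<1
  ^-pos x>0 (suc n) = *-pos x>0 (^-pos x>0 n)

  ^-monoˡ-≤ : 0# ≤ x → x ≤ y → ∀ n → x ^ n ≤ y ^ n
  ^-monoˡ-≤ x≥0 x≤y zero    = ≤-refl
  ^-monoˡ-≤ x≥0 x≤y (suc n) = *-mono-≤ x≥0 x≤y (^-nonneg x≥0 n) (^-monoˡ-≤ x≥0 x≤y n)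

  ^-≤1 : 0# ≤ x → x ≤ 1# → ∀ n → x ^ n ≤ 1#
  ^-≤1 x≥0 x≤1 zero    = ≤-refl
  ^-≤1 x≥0 x≤1 (suc n) = ≤-trans (*-mono-≤ x≥0 x≤1 (^-nonneg x≥0 n) (^-≤1 x≥0 x≤1 n))
                                 (≤-reflexive (*-identityˡ 1#))

  ^-≥1 : 1# ≤ x → ∀ n → 1# ≤ x ^ n
  ^-≥1 x≥1 zero    = ≤-refl
  ^-≥1 x≥1 (suc n) = *-≥1 x≥1 (^-≥1 x≥1 n)

  ^-anti-≤ : 0# ≤ x → x ≤ 1# → ∀ {m n} → m ℕ.≤ n → x ^ n ≤ x ^ m
  ^-anti-≤ x≥0 x≤1 {n = n} ℕ.z≤n = ^-≤1 x≥0 x≤1 n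
  ^-anti-≤ x≥0 x≤1 (ℕ.s≤s m≤n) = *-monoˡ-≤ x≥0 (^-anti-≤ x≥0 x≤1 m≤n)

  ^-mono-≤ : 1# ≤ x → ∀ {m n} → m ℕ.≤ n → x ^ m ≤ x ^ n
  ^-mono-≤ x≥1 {n = n} ℕ.z≤n = ^-≥1 x≥1 n
  ^-mono-≤ x≥1 (ℕ.s≤s m≤n) = *-monoˡ-≤ (≤-trans 0≤1 x≥1) (^-mono-≤ x≥1 m≤n)

  ^-≡ : ∀ x {m n} → m ≡ n → x ^ m ≈ x ^ n
  ^-≡ x ≡.refl = refl

  fromℕ-+ : ∀ m n → fromℕ (m ℕ.+ n) ≈ fromℕ m + fromℕ n
  fromℕ-+ = Mult.×-homo-+ semiring 1#

  fromℕ-* : ∀ m n → fromℕ (m ℕ.* n) ≈ fromℕ m * fromℕ n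
  fromℕ-* = Mult.×1-homo-* semiring

  fromℕ-^ : ∀ m n → fromℕ (m ℕ.^ n) ≈ fromℕ m ^ n
  fromℕ-^ m zero    = +-identityʳ 1#
  fromℕ-^ m (suc n) = trans (fromℕ-* m (m ℕ.^ n)) (*-congˡ (fromℕ-^ m n))

  fromℕ-nonneg : ∀ n → 0# ≤ fromℕ n
  fromℕ-nonneg zero    = ≤-refl
  fromℕ-nonneg (suc n) = +-nonneg 0≤1 (fromℕ-nonneg n)

  fromℕ-mono-≤ : ∀ {m n} → m ℕ.≤ n → fromℕ m ≤ fromℕ n
  fromℕ-mono-≤ {n = n} ℕ.z≤n = fromℕ-nonneg n
  fromℕ-mono-≤ (ℕ.s≤s m≤n)   = +-monoʳ-≤ 1# (fromℕ-mono-≤ m≤n)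

  1≤fromℕ : ∀ n → 1# ≤ fromℕ (suc n)
  1≤fromℕ n = x≤x+y (fromℕ-nonneg n)

  x≤n*x : ∀ n → 0# ≤ x → x ≤ fromℕ (suc n) * x
  x≤n*x n x≥0 = ≤-trans (≤-reflexive (sym (*-identityˡ _))) (*-monoʳ-≤ x≥0 (1≤fromℕ n))

  recip-cancel : ∀ x (x>0 : 0# < x) y → x * (y * recip x x>0) ≈ y
  recip-cancel x x>0 y = trans (solve 3 (λ x y r → x :* (y :* r) := y :* (x :* r)) refl x y _)
    (trans (*-congˡ (*-recip x x>0)) (*-identityʳ y))

  ½ : Carrier
  ½ = recip (fromℕ 2) (fromℕ-pos 2)

  ½-pos : 0# < ½
  ½-pos = recip-pos (fromℕ 2) (fromℕ-pos 2)

  ½+½≈1 : ½ + ½ ≈ 1#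
  ½+½≈1 = trans (solve 1 (λ a → a :+ a := (:1 :+ (:1 :+ :0)) :* a) refl ½)
                (*-recip (fromℕ 2) (fromℕ-pos 2))

  halves : ∀ x → x ≈ ½ * x + ½ * x
  halves x = trans (sym (*-identityˡ x)) (trans (*-congʳ (sym ½+½≈1)) (distribʳ x ½ ½))

  -- Positivity of `exp` is not an axiom; it is obtained by writing `exp x` as the square of
  -- `exp (½ * x)`.
  exp-nonneg : ∀ x → 0# ≤ exp x
  exp-nonneg x = ≤-trans (square-nonneg (exp (½ * x)))
    (≤-reflexive (trans (sym (exp-+ _ _)) (exp-cong (sym (halves x)))))

  exp-mono-≤ : x ≤ y → exp x ≤ exp y
  exp-mono-≤ {x} {y} x≤y = begin
    exp x                    ≈⟨ *-identityʳ _ ⟨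
    exp x * 1#               ≤⟨ *-monoˡ-≤ (exp-nonneg x) (x≤x+y (x≤y⇒0≤y-x x≤y)) ⟩
    exp x * (1# + (y - x))   ≤⟨ *-monoˡ-≤ (exp-nonneg x) (1+x≤exp (y - x)) ⟩
    exp x * exp (y - x)      ≈⟨ exp-+ _ _ ⟨
    exp (x + (y - x))        ≈⟨ exp-cong (solve 2 (λ a b → a :+ (b :- a) := b) refl x y) ⟩
    exp y                    ∎

  x≤exp : ∀ x → x ≤ exp x
  x≤exp x = ≤-trans (x≤y+x 0≤1) (1+x≤exp x)

  exp-≥1 : 0# ≤ x → 1# ≤ exp x
  exp-≥1 x≥0 = ≤-trans (x≤x+y x≥0) (1+x≤exp _)

  exp-inverseʳ : ∀ x → exp x * exp (- x) ≈ 1#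
  exp-inverseʳ x = trans (sym (exp-+ _ _)) (trans (exp-cong (-‿inverseʳ x)) exp-0)

  exp-fromℕ-* : ∀ m x → exp (fromℕ m * x) ≈ exp x ^ m
  exp-fromℕ-* zero    x = trans (exp-cong (zeroˡ x)) exp-0
  exp-fromℕ-* (suc m) x =
    trans (exp-cong (solve 2 (λ a b → (:1 :+ a) :* b := b :+ a :* b) refl (fromℕ m) x))
    (trans (exp-+ _ _) (*-congˡ (exp-fromℕ-* m x)))

  1-x≤exp[-x] : ∀ x → 1# - x ≤ exp (- x)
  1-x≤exp[-x] x = 1+x≤exp (- x)

  log-≥ : ∀ x (x>0 : 0# < x) y → exp y < x → y ≤ log x x>0
  log-≥ x x>0 y ey<x l<y = ≤-trans (≤-reflexive (sym (exp-log x x>0))) (exp-mono-≤ (<⇒≤ l<y)) ey<x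

  ∏ : (ℕ → Carrier) → ℕ → ℕ → Carrier
  ∏ m i zero    = 1#
  ∏ m i (suc j) = m i * ∏ m (suc i) j

  ∏-nonneg : ∀ {m} → (∀ i → 0# ≤ m i) → ∀ i j → 0# ≤ ∏ m i j
  ∏-nonneg m≥0 i zero    = 0≤1
  ∏-nonneg m≥0 i (suc j) = *-nonneg (m≥0 i) (∏-nonneg m≥0 (suc i) j)

-- Finite sets

module FiniteSets where
  open import Data.Fin.Subset using (_-_)
  open ≡ using (refl; sym; trans; cong; cong₂; subst)

  C-monoˡ-≤ : ∀ {m n} k → m ℕ.≤ n → m C k ℕ.≤ n C k
  C-monoˡ-≤ {m} {n} k m≤n = go (ℕ.≤⇒≤′ m≤n)
    where
    step : ∀ n k → n C k ℕ.≤ suc n C k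
    step n zero    = ℕ.≤-refl
    step n (suc k) = ℕ.≤-trans (ℕ.m≤n+m _ (n C k)) (ℕ.≤-reflexive (nCk+nC[k+1]≡[n+1]C[k+1] n k))

    go : ∀ {n} → m ℕ.≤′ n → m C k ℕ.≤ n C k
    go ℕ.≤′-refl            = ℕ.≤-refl
    go (ℕ.≤′-step {n} m≤′n) = ℕ.≤-trans (go m≤′n) (step n k)

  C-≤-^ : ∀ n k → n C k ℕ.≤ n ℕ.^ k
  C-≤-^ n       zero    = ℕ.≤-refl
  C-≤-^ zero    (suc k) = ℕ.z≤n
  C-≤-^ (suc n) (suc k) = begin
    suc n C suc k                  ≡⟨ nCk+nC[k+1]≡[n+1]C[k+1] n k ⟨
    n C k ℕ.+ n C suc k            ≤⟨ ℕ.+-mono-≤ (C-≤-^ n k) (C-≤-^ n (suc k)) ⟩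
    suc n ℕ.* n ℕ.^ k              ≤⟨ ℕ.*-monoʳ-≤ (suc n) (ℕ.^-monoˡ-≤ k (ℕ.n≤1+n n)) ⟩
    suc n ℕ.^ suc k                ∎
    where open ℕ.≤-Reasoning

  module _ {n : ℕ} where

    private
      variable
        A B W : Subset n
        v w : Fin n

    ∪-⊆ : A ⊆ˢ W → v ∈ˢ W → A ∪ ⁅ v ⁆ ⊆ˢ W
    ∪-⊆ {A} {W} {v} A⊆W v∈W x∈ = [ A⊆W , (λ x∈v → subst (_∈ˢ W) (sym (Subset.x∈⁅y⁆⇒x≡y v x∈v)) v∈W) ]′
      (Subset.x∈p∪q⁻ A ⁅ v ⁆ x∈)

    v∈A∪⁅v⁆ : ∀ (A : Subset n) v → v ∈ˢ A ∪ ⁅ v ⁆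
    v∈A∪⁅v⁆ A v = Subset.x∈p∪q⁺ (inj₂ (Subset.x∈⁅x⁆ v))

  v∉A-v : ∀ {n} (A : Subset n) v → v ∉ˢ A - v
  v∉A-v (_       ∷ A) zero    ()
  v∉A-v (inside  ∷ A) (suc v) (there v∈) = v∉A-v A v v∈
  v∉A-v (outside ∷ A) (suc v) (there v∈) = v∉A-v A v v∈

  ∣A∪⁅v⁆∣ : ∀ {n} (A : Subset n) {v} → v ∉ˢ A → ∣ A ∪ ⁅ v ⁆ ∣ ≡ suc ∣ A ∣
  ∣A∪⁅v⁆∣ (inside  ∷ A) {zero}  v∉A = contradiction here v∉A
  ∣A∪⁅v⁆∣ (outside ∷ A) {zero}  v∉A = cong (suc ∘ ∣_∣) (Subset.∪-identityʳ A)
  ∣A∪⁅v⁆∣ (inside  ∷ A) {suc v} v∉A = cong suc (∣A∪⁅v⁆∣ A (v∉A ∘ there))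
  ∣A∪⁅v⁆∣ (outside ∷ A) {suc v} v∉A = ∣A∪⁅v⁆∣ A (v∉A ∘ there)

  module _ {n : ℕ} where

    private
      variable
        A B W : Subset n
        v w : Fin n

    A-v∪⁅v⁆ : v ∈ˢ A → (A - v) ∪ ⁅ v ⁆ ≡ A
    A-v∪⁅v⁆ {v} {A} v∈A = Subset.⊆-antisym (∪-⊆ (Subset.p─q⊆p A ⁅ v ⁆) v∈A) ⊇
      where
      ⊇ : A ⊆ˢ (A - v) ∪ ⁅ v ⁆
      ⊇ {x} x∈A with x Fin.≟ v
      ... | yes refl = v∈A∪⁅v⁆ (A - v) v
      ... | no x≢v   = Subset.x∈p∪q⁺ (inj₁ (Subset.x∈p∧x≢y⇒x∈p-y x∈A x≢v))

    suc∣A-v∣ : v ∈ˢ A → suc ∣ A - v ∣ ≡ ∣ A ∣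
    suc∣A-v∣ {v} {A} v∈A = trans (sym (∣A∪⁅v⁆∣ (A - v) (v∉A-v A v))) (cong ∣_∣ (A-v∪⁅v⁆ v∈A))

    ⊆-∪-∉ : B ⊆ˢ A ∪ ⁅ v ⁆ → v ∉ˢ B → B ⊆ˢ A
    ⊆-∪-∉ {B} {A} {v} B⊆ v∉B x∈B = [ (λ x∈A → x∈A)
      , (λ x∈v → contradiction (subst (_∈ˢ B) (Subset.x∈⁅y⁆⇒x≡y v x∈v) x∈B) v∉B) ]′
      (Subset.x∈p∪q⁻ A ⁅ v ⁆ (B⊆ x∈B))

    ∃-∈-∉ : ∣ A ∣ ℕ.< ∣ W ∣ → ∃[ v ] v ∈ˢ W × v ∉ˢ A
    ∃-∈-∉ {A} {W} lt with Fin.any? (λ v → (v Subset.∈? W) ×-dec ¬? (v Subset.∈? A))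
      where open import Relation.Nullary.Decidable using (_×-dec_)
    ... | yes found = found
    ... | no  none  = contradiction lt (ℕ.≤⇒≯ (Subset.p⊆q⇒∣p∣≤∣q∣
      (λ {v} v∈W → decidable-stable (v Subset.∈? A) (λ v∉A → none (v , v∈W , v∉A)))))

    ⊆-∣∣-≡ : A ⊆ˢ W → ∣ A ∣ ≡ ∣ W ∣ → A ≡ W
    ⊆-∣∣-≡ {A} {W} A⊆W eq = Subset.⊆-antisym A⊆W λ {v} v∈W → decidable-stable (v Subset.∈? A)
      λ v∉A → ℕ.<⇒≢ (Subset.p⊂q⇒∣p∣<∣q∣ (A⊆W , v , v∈W , v∉A)) eq

    ∪⁅⁆-injective : v ∉ˢ A → w ∉ˢ A → ∀ {B D} → B ⊆ˢ A → D ⊆ˢ A → B ∪ ⁅ v ⁆ ≡ D ∪ ⁅ w ⁆ → v ≡ w × B ≡ D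
    ∪⁅⁆-injective {v} {A} {w} v∉A w∉A {B} {D} B⊆A D⊆A eq =
      v≡w , Subset.⊆-antisym (below B⊆A w∉A eq) (below D⊆A v∉A (sym eq))
      where
      v≡w : v ≡ w
      v≡w = [ (λ v∈D → contradiction (D⊆A v∈D) v∉A) , Subset.x∈⁅y⁆⇒x≡y w ]′
        (Subset.x∈p∪q⁻ D ⁅ w ⁆ (subst (v ∈ˢ_) eq (v∈A∪⁅v⁆ B v)))

      below : ∀ {B D v w} → B ⊆ˢ A → w ∉ˢ A → B ∪ ⁅ v ⁆ ≡ D ∪ ⁅ w ⁆ → B ⊆ˢ D
      below {B} B⊆A w∉A eq = ⊆-∪-∉ (subst (B ⊆ˢ_) eq (Subset.p⊆p∪q _)) (w∉A ∘ B⊆A)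

  module _ {a} {X : Set a} where

    Unique-resp-↭ : ∀ {xs ys : List X} → xs ↭ ys → Unique xs → Unique ys
    Unique-resp-↭ ↭.refl         u                     = u
    Unique-resp-↭ (↭.prep x p)   (d ∷ u)               = ↭.All-resp-↭ p d ∷ Unique-resp-↭ p u
    Unique-resp-↭ (↭.swap x y p) ((x≢y ∷ d) ∷ (e ∷ u)) =
      ((x≢y ∘ sym) ∷ ↭.All-resp-↭ p e) ∷ (↭.All-resp-↭ p d ∷ Unique-resp-↭ p u)
    Unique-resp-↭ (↭.trans p p′) u                     = Unique-resp-↭ p′ (Unique-resp-↭ p u)

    Unique-++⁻ʳ : ∀ (xs : List X) {ys} → Unique (xs ++ ys) → Unique ys
    Unique-++⁻ʳ []       u       = u
    Unique-++⁻ʳ (_ ∷ xs) (_ ∷ u) = Unique-++⁻ʳ xs u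

  -- Built by recursion on the set instead of filtering `allSubsets`, so that the recursion mirrors
  -- Pascal's rule and gives the count directly.
  subsetsOf : ∀ {n} → Subset n → ℕ → List (Subset n)
  subsetsOf []            zero    = [] ∷ []
  subsetsOf []            (suc r) = []
  subsetsOf (outside ∷ A) r       = map (outside ∷_) (subsetsOf A r)
  subsetsOf (inside  ∷ A) zero    = map (outside ∷_) (subsetsOf A zero)
  subsetsOf (inside  ∷ A) (suc r) = map (inside ∷_) (subsetsOf A r) ++ map (outside ∷_) (subsetsOf A (suc r))

  length-subsetsOf : ∀ {n} (A : Subset n) r → length (subsetsOf A r) ≡ ∣ A ∣ C r
  length-subsetsOf []            zero    = refl
  length-subsetsOf []            (suc r) = refl
  length-subsetsOf (outside ∷ A) r       = trans (List.length-map _ (subsetsOf A r)) (length-subsetsOf A r)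
  length-subsetsOf (inside  ∷ A) zero    = trans (List.length-map _ (subsetsOf A zero)) (length-subsetsOf A zero)
  length-subsetsOf (inside  ∷ A) (suc r) =
    trans (List.length-++ (map (inside ∷_) (subsetsOf A r)))
    (trans (cong₂ ℕ._+_ (trans (List.length-map _ (subsetsOf A r)) (length-subsetsOf A r))
                        (trans (List.length-map _ (subsetsOf A (suc r))) (length-subsetsOf A (suc r))))
           (nCk+nC[k+1]≡[n+1]C[k+1] ∣ A ∣ r))

  private
    ∷-disjoint : ∀ {n} {xs ys : List (Subset n)} {B : Subset (suc n)} →
                 ¬ (B ∈ˡ map (inside ∷_) xs × B ∈ˡ map (outside ∷_) ys)
    ∷-disjoint (∈in , ∈out) with ∈.∈-map⁻ (inside ∷_) ∈in | ∈.∈-map⁻ (outside ∷_) ∈out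
    ... | _ , _ , refl | _ , _ , ()

  Unique-subsetsOf : ∀ {n} (A : Subset n) r → Unique (subsetsOf A r)
  Unique-subsetsOf []            zero    = [] ∷ []
  Unique-subsetsOf []            (suc r) = []
  Unique-subsetsOf (outside ∷ A) r       = Unique.map⁺ Vec.∷-injectiveʳ (Unique-subsetsOf A r)
  Unique-subsetsOf (inside  ∷ A) zero    = Unique.map⁺ Vec.∷-injectiveʳ (Unique-subsetsOf A zero)
  Unique-subsetsOf (inside  ∷ A) (suc r) = Unique.++⁺
    (Unique.map⁺ Vec.∷-injectiveʳ (Unique-subsetsOf A r))
    (Unique.map⁺ Vec.∷-injectiveʳ (Unique-subsetsOf A (suc r)))
    ∷-disjoint

  _IsSubset_OfSize_ : ∀ {n} → Subset n → Subset n → ℕ → Set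
  B IsSubset A OfSize r = B ⊆ˢ A × ∣ B ∣ ≡ r

  ∈-subsetsOf⁻ : ∀ {n} (A : Subset n) r → All (_IsSubset A OfSize r) (subsetsOf A r)
  ∈-subsetsOf⁻ []            zero    = ((λ ()) , refl) ∷ []
  ∈-subsetsOf⁻ []            (suc r) = []
  ∈-subsetsOf⁻ (outside ∷ A) r       = All.map⁺ (All.map out (∈-subsetsOf⁻ A r))
    where
    out : ∀ {B} → B IsSubset A OfSize r → (outside ∷ B) IsSubset (outside ∷ A) OfSize r
    out (B⊆A , eq) = Subset.s⊆s B⊆A , eq
  ∈-subsetsOf⁻ (inside  ∷ A) zero    = All.map⁺ (All.map out (∈-subsetsOf⁻ A zero))
    where
    out : ∀ {B} → B IsSubset A OfSize zero → (outside ∷ B) IsSubset (inside ∷ A) OfSize zero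
    out (B⊆A , eq) = Subset.out⊆ B⊆A , eq
  ∈-subsetsOf⁻ (inside  ∷ A) (suc r) = All.++⁺
    (All.map⁺ (All.map in′ (∈-subsetsOf⁻ A r)))
    (All.map⁺ (All.map out (∈-subsetsOf⁻ A (suc r))))
    where
    in′ : ∀ {B} → B IsSubset A OfSize r → (inside ∷ B) IsSubset (inside ∷ A) OfSize suc r
    in′ (B⊆A , eq) = Subset.s⊆s B⊆A , cong suc eq

    out : ∀ {B} → B IsSubset A OfSize suc r → (outside ∷ B) IsSubset (inside ∷ A) OfSize suc r
    out (B⊆A , eq) = Subset.out⊆ B⊆A , eq

  ∈-subsetsOf-⊤ : ∀ {n} (B : Subset n) → B ∈ˡ subsetsOf ⊤ ∣ B ∣
  ∈-subsetsOf-⊤ []            = here refl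
  ∈-subsetsOf-⊤ (inside  ∷ B) = ∈.∈-++⁺ˡ (∈.∈-map⁺ (inside ∷_) (∈-subsetsOf-⊤ B))
  ∈-subsetsOf-⊤ (outside ∷ B) with ∣ B ∣ | ∈-subsetsOf-⊤ B
  ... | zero  | B∈ = ∈.∈-map⁺ (outside ∷_) B∈
  ... | suc r | B∈ = ∈.∈-++⁺ʳ (map (inside ∷_) (subsetsOf ⊤ r)) (∈.∈-map⁺ (outside ∷_) B∈)

  length-subsetsOf-⊤ : ∀ n r → length (subsetsOf {n} ⊤ r) ℕ.≤ n ℕ.^ r
  length-subsetsOf-⊤ n r = ℕ.≤-trans
    (ℕ.≤-reflexive (trans (length-subsetsOf {n} ⊤ r) (cong (_C r) (Subset.∣⊤∣≡n n)))) (C-≤-^ n r)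

  Unique-allSubsets : ∀ n → Unique (allSubsets n)
  Unique-allSubsets zero    = [] ∷ []
  Unique-allSubsets (suc n) = Unique.++⁺
    (Unique.map⁺ Vec.∷-injectiveʳ (Unique-allSubsets n))
    (Unique.map⁺ Vec.∷-injectiveʳ (Unique-allSubsets n))
    ∷-disjoint

  ∈-allSubsets : ∀ {n} (B : Subset n) → B ∈ˡ allSubsets n
  ∈-allSubsets []            = here refl
  ∈-allSubsets (inside  ∷ B) = ∈.∈-++⁺ˡ (∈.∈-map⁺ (inside ∷_) (∈-allSubsets B))
  ∈-allSubsets (outside ∷ B) =
    ∈.∈-++⁺ʳ (map (inside ∷_) (allSubsets _)) (∈.∈-map⁺ (outside ∷_) (∈-allSubsets B))

  Unique-subsetsOfSize : ∀ n s → Unique (subsetsOfSize n s)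
  Unique-subsetsOfSize n s = Unique.filter⁺ (λ p → ∣ p ∣ ℕ.≟ s) (Unique-allSubsets n)

  ∈-subsetsOfSize : ∀ {n s} (B : Subset n) → ∣ B ∣ ≡ s → B ∈ˡ subsetsOfSize n s
  ∈-subsetsOfSize {s = s} B eq = ∈.∈-filter⁺ (λ p → ∣ p ∣ ℕ.≟ s) (∈-allSubsets B) eq

  module _ {n : ℕ} where

    private
      variable
        A W : Subset n
        v : Fin n
        vs : List (Fin n)

    toSubset-∷ : ∀ (v : Fin n) vs → toSubset (v ∷ vs) ≡ toSubset vs ∪ ⁅ v ⁆
    toSubset-∷ v vs = Subset.∪-comm ⁅ v ⁆ (toSubset vs)

    ∈-toSubset⁺ : v ∈ˡ vs → v ∈ˢ toSubset vs
    ∈-toSubset⁺ (here refl)  = Subset.x∈p∪q⁺ (inj₁ (Subset.x∈⁅x⁆ _))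
    ∈-toSubset⁺ (there v∈vs) = Subset.x∈p∪q⁺ (inj₂ (∈-toSubset⁺ v∈vs))

    ∈-toSubset⁻ : ∀ vs → v ∈ˢ toSubset vs → v ∈ˡ vs
    ∈-toSubset⁻ []       v∈ = contradiction v∈ Subset.∉⊥
    ∈-toSubset⁻ (w ∷ vs) v∈ = [ (λ v∈w → here (Subset.x∈⁅y⁆⇒x≡y w v∈w))
      , (λ v∈vs → there (∈-toSubset⁻ vs v∈vs)) ]′ (Subset.x∈p∪q⁻ ⁅ w ⁆ (toSubset vs) v∈)

    ∣toSubset∣ : Unique vs → ∣ toSubset vs ∣ ≡ length vs
    ∣toSubset∣ {[]}     []              = Subset.∣⊥∣≡0 n
    ∣toSubset∣ {v ∷ vs} u@(_ ∷ uvs) = trans (cong ∣_∣ (toSubset-∷ v vs))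
      (trans (∣A∪⁅v⁆∣ (toSubset vs) (Unique.Unique[x∷xs]⇒x∉xs u ∘ ∈-toSubset⁻ vs))
             (cong suc (∣toSubset∣ uvs)))

    toSubset-∷-⊆ : v ∈ˢ W → toSubset vs ⊆ˢ W → toSubset (v ∷ vs) ⊆ˢ W
    toSubset-∷-⊆ {v} {W} {vs} v∈W vs⊆W = subst (_⊆ˢ W) (sym (toSubset-∷ v vs)) (∪-⊆ vs⊆W v∈W)

  module _ {a} {X : Set a} where

    length-tuples : ∀ m (xs : List X) → length (tuples m xs) ≡ length xs ℕ.^ m
    length-tuples zero    xs = refl
    length-tuples (suc m) xs = go xs
      where
      go : ∀ ys → length (concatMap (λ x → map (x ∷_) (tuples m xs)) ys) ≡ length ys ℕ.* length xs ℕ.^ m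
      go []       = refl
      go (y ∷ ys) = trans (List.length-++ (map (y ∷_) (tuples m xs)))
        (cong₂ ℕ._+_ (trans (List.length-map _ (tuples m xs)) (length-tuples m xs)) (go ys))

    ∈-tuples⁻ : ∀ m (xs : List X) → All (λ ys → length ys ≡ m) (tuples m xs)
    ∈-tuples⁻ zero    xs = refl ∷ []
    ∈-tuples⁻ (suc m) xs = All.concat⁺ (All.map⁺ (All.universal
      (λ x → All.map⁺ (All.map (cong suc) (∈-tuples⁻ m xs))) xs))

    ∈-tuples⁺ : ∀ {xs ys : List X} → All (_∈ˡ xs) ys → ys ∈ˡ tuples (length ys) xs
    ∈-tuples⁺ []             = here refl
    ∈-tuples⁺ (y∈xs ∷ ys∈xs) = ∈.∈-concat⁺′ (∈.∈-map⁺ (_ ∷_) (∈-tuples⁺ ys∈xs)) (∈.∈-map⁺ _ y∈xs)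

  length-distinctTuples : ∀ n m → length (distinctTuples n m) ℕ.≤ n ℕ.^ m
  length-distinctTuples n m = ℕ.≤-trans (List.length-filter (unique? Fin._≟_) (tuples m (allFin n)))
    (ℕ.≤-reflexive (trans (length-tuples m (allFin n)) (cong (ℕ._^ m) (List.length-tabulate _))))

  ∈-distinctTuples⁻ : ∀ {n m} {vs : List (Fin n)} → vs ∈ˡ distinctTuples n m → Unique vs × length vs ≡ m
  ∈-distinctTuples⁻ {n} {m} vs∈ with ∈.∈-filter⁻ (unique? Fin._≟_) {xs = tuples m (allFin n)} vs∈
  ... | vs∈tuples , u = u , All.lookup (∈-tuples⁻ m (allFin n)) vs∈tuples

  ∈-distinctTuples⁺ : ∀ {n} {vs : List (Fin n)} → Unique vs → vs ∈ˡ distinctTuples n (length vs)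
  ∈-distinctTuples⁺ u =
    ∈.∈-filter⁺ (unique? Fin._≟_) (∈-tuples⁺ (All.universal ∈.∈-allFin _)) u

  ∃-distinctTuple-⊆ : ∀ {n} (W : Subset n) m → m ℕ.≤ ∣ W ∣ →
    ∃[ vs ] Unique vs × length vs ≡ m × toSubset vs ⊆ˢ W
  ∃-distinctTuple-⊆ W zero    m≤W = [] , [] , refl , Subset.⊥⊆
  ∃-distinctTuple-⊆ W (suc m) m<W with ∃-distinctTuple-⊆ W m (ℕ.<⇒≤ m<W)
  ... | vs , u , refl , vs⊆W with ∃-∈-∉ (subst (ℕ._< ∣ W ∣) (sym (∣toSubset∣ u)) m<W)
  ...   | v , v∈W , v∉vs = v ∷ vs
    , All.¬Any⇒All¬ vs (v∉vs ∘ ∈-toSubset⁺) ∷ u , refl , toSubset-∷-⊆ {vs = vs} v∈W vs⊆W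

  -- For `v` outside `A`, these are exactly the edges whose presence makes `v` a common neighbour of
  -- `A` when s = r + 1.
  edgesAt : ∀ {n} → Subset n → ℕ → Fin n → List (Subset n)
  edgesAt A r v = map (_∪ ⁅ v ⁆) (subsetsOf A r)

  outsiders : ∀ {n} → Subset n → List (Fin n)
  outsiders {n} A = filter (λ v → ¬? (v Subset.∈? A)) (allFin n)

  length-outsiders : ∀ {n} (A : Subset n) → length (outsiders A) ℕ.≤ n
  length-outsiders {n} A = ℕ.≤-trans (List.length-filter _ (allFin n))
    (ℕ.≤-reflexive (List.length-tabulate _))

  module _ {n : ℕ} (A : Subset n) (r : ℕ) where

    private
      member : ∀ {v B} → B ∈ˡ edgesAt A r v → ∃[ D ] D ⊆ˢ A × ∣ D ∣ ≡ r × B ≡ D ∪ ⁅ v ⁆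
      member B∈ with ∈.∈-map⁻ _ B∈
      ... | D , D∈ , refl with All.lookup (∈-subsetsOf⁻ A r) D∈
      ...   | D⊆A , ∣D∣ = D , D⊆A , ∣D∣ , refl

      All-∉ : All (_∉ˢ A) (outsiders A)
      All-∉ = All.all-filter _ (allFin n)

    length-edgesAt : ∀ v → length (edgesAt A r v) ≡ ∣ A ∣ C r
    length-edgesAt v = trans (List.length-map _ (subsetsOf A r)) (length-subsetsOf A r)

    -- Removing the outside vertex recovers both the vertex and the subset of `A`, so no edge is
    -- listed twice. This disjointness is what makes the events that different vertices are common
    -- neighbours independent.
    Unique-edges : Unique (concatMap (edgesAt A r) (outsiders A))
    Unique-edges = Unique.concat⁺ (All.map⁺ (All.map each All-∉))
      (AllPairs.map⁺ (disjoint All-∉ (Unique.filter⁺ _ (Unique.allFin⁺ n))))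
      where
      each : ∀ {v} → v ∉ˢ A → Unique (edgesAt A r v)
      each v∉A = AllPairs.map⁺ (distinct (∈-subsetsOf⁻ A r) (Unique-subsetsOf A r))
        where
        distinct : ∀ {Bs} → All (_IsSubset A OfSize r) Bs → Unique Bs →
                   AllPairs.AllPairs (λ B D → B ∪ ⁅ _ ⁆ ≢ D ∪ ⁅ _ ⁆) Bs
        distinct []                []       = []
        distinct ((B⊆A , _) ∷ Bs⊆) (d ∷ ds) = All.zipWith
          (λ ((D⊆A , _) , B≢D) eq → B≢D (proj₂ (∪⁅⁆-injective v∉A v∉A B⊆A D⊆A eq))) (Bs⊆ , d)
          ∷ distinct Bs⊆ ds

      disjoint : ∀ {vs} → All (_∉ˢ A) vs → Unique vs →
                 AllPairs.AllPairs (λ v w → ∀ {B} → ¬ (B ∈ˡ edgesAt A r v × B ∈ˡ edgesAt A r w)) vs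
      disjoint []         []       = []
      disjoint {v ∷ _} (v∉ ∷ vs∉) (d ∷ ds) = All.zipWith apart (vs∉ , d) ∷ disjoint vs∉ ds
        where
        apart : ∀ {w} → w ∉ˢ A × v ≢ w → ∀ {B} → ¬ (B ∈ˡ edgesAt A r v × B ∈ˡ edgesAt A r w)
        apart (w∉ , v≢w) (B∈v , B∈w) with member B∈v | member B∈w
        ... | D , D⊆A , _ , eq | D′ , D′⊆A , _ , eq′ =
          v≢w (proj₁ (∪⁅⁆-injective v∉ w∉ D⊆A D′⊆A (trans (sym eq) eq′)))

    edges-⊆ : All (_∈ˡ subsetsOfSize n (suc r)) (concatMap (edgesAt A r) (outsiders A))
    edges-⊆ = All.concat⁺ (All.map⁺ (All.map each All-∉))
      where
      each : ∀ {v} → v ∉ˢ A → All (_∈ˡ subsetsOfSize n (suc r)) (edgesAt A r v)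
      each v∉A = All.map⁺ (All.map (λ (B⊆A , ∣B∣) → ∈-subsetsOfSize _
        (trans (∣A∪⁅v⁆∣ _ (v∉A ∘ B⊆A)) (cong suc ∣B∣))) (∈-subsetsOf⁻ A r))

  -- Cliques and common neighbours

  module Cliques {n : ℕ} (r : ℕ) (G : Hypergraph n) where

    private
      s = suc r

    -- An s-subset of `A ∪ ⁅ v ⁆` either avoids `v` and is an edge of the old clique, or consists of
    -- `v` and an (s - 1)-subset of `A` and is an edge by adjacency.
    clique-extend : ∀ {i A v} → IsClique s G i A → IsCommonNeighbour s G A v → IsClique s G (suc i) (A ∪ ⁅ v ⁆)
    clique-extend {i} {A} {v} (∣A∣ , edges) (v∉A , adjacent) = trans (∣A∪⁅v⁆∣ A v∉A) (cong suc ∣A∣) , all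
      where
      all : ∀ B → ∣ B ∣ ≡ s → B ⊆ˢ A ∪ ⁅ v ⁆ → B ∈ G
      all B ∣B∣ B⊆ with v Subset.∈? B
      ... | no v∉B  = edges B ∣B∣ (⊆-∪-∉ B⊆ v∉B)
      ... | yes v∈B = subst (_∈ G) (A-v∪⁅v⁆ v∈B)
        (adjacent (B - v) (trans (suc∣A-v∣ v∈B) ∣B∣)
          (⊆-∪-∉ (λ x∈ → B⊆ (Subset.p─q⊆p B ⁅ v ⁆ x∈)) (v∉A-v B v)))

    clique-neighbour : ∀ {k A W v} → IsClique s G k W → A ⊆ˢ W → v ∈ˢ W → v ∉ˢ A → v ∈ˡ CN s G A
    clique-neighbour {A = A} {W} {v} (_ , edges) A⊆W v∈W v∉A =
      ∈.∈-filter⁺ (isCommonNeighbour? s G A) (∈.∈-allFin v) (v∉A , λ B ∣B∣ B⊆A →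
        edges (B ∪ ⁅ v ⁆) (trans (∣A∪⁅v⁆∣ B (v∉A ∘ B⊆A)) ∣B∣) (∪-⊆ (λ x∈B → A⊆W (B⊆A x∈B)) v∈W))

    -- A set of s - 1 vertices has no s-subset, so the edge condition is vacuous.
    clique-start : ∀ {vs} → vs ∈ˡ distinctTuples n r → IsClique s G r (toSubset vs)
    clique-start {vs} vs∈ with ∈-distinctTuples⁻ vs∈
    ... | unique , length≡r = ∣vs∣ , λ B ∣B∣ B⊆ → contradiction (Subset.p⊆q⇒∣p∣≤∣q∣ B⊆)
      (ℕ.<⇒≱ (ℕ.≤-reflexive (trans (cong suc ∣vs∣) (sym ∣B∣))))
      where
      ∣vs∣ : ∣ toSubset vs ∣ ≡ r
      ∣vs∣ = trans (∣toSubset∣ unique) length≡r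

-- Finitely supported distributions

module Expectation {c ℓ₁ ℓ₂} (R : RealNumbers c ℓ₁ ℓ₂) where
  open RealNumbers R
  open GreedyRandomSampling R
  open RealFacts R
  open ≤-Reasoning
  open IntegerRingSolver commutativeRing using (solve; :0; :1; _:+_; _:*_; _:-_; :-_; _:=_)

  private
    variable
      a b p r : Level
      A : Set a
      B : Set b
      P : Pred A p
      Q : Pred B r

  ∑ : List A → (A → Carrier) → Carrier
  ∑ []       g = 0#
  ∑ (x ∷ xs) g = g x + ∑ xs g

  ∑-cong : ∀ (xs : List A) {g h : A → Carrier} → (∀ x → g x ≈ h x) → ∑ xs g ≈ ∑ xs h
  ∑-cong []       eq = refl
  ∑-cong (x ∷ xs) eq = +-cong (eq x) (∑-cong xs eq)

  ∑-mono : ∀ {xs : List A} {g h : A → Carrier} → All (λ x → g x ≤ h x) xs → ∑ xs g ≤ ∑ xs h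
  ∑-mono []         = ≤-refl
  ∑-mono (le ∷ les) = +-mono-≤ le (∑-mono les)

  ∑-nonneg : ∀ (xs : List A) {g : A → Carrier} → (∀ x → 0# ≤ g x) → 0# ≤ ∑ xs g
  ∑-nonneg []       g≥0 = ≤-refl
  ∑-nonneg (x ∷ xs) g≥0 = +-nonneg (g≥0 x) (∑-nonneg xs g≥0)

  ∑-++ : ∀ (xs ys : List A) g → ∑ (xs ++ ys) g ≈ ∑ xs g + ∑ ys g
  ∑-++ []       ys g = sym (+-identityˡ _)
  ∑-++ (x ∷ xs) ys g = trans (+-congˡ (∑-++ xs ys g)) (sym (+-assoc _ _ _))

  ∑-map : ∀ (f : A → B) xs g → ∑ (map f xs) g ≡ ∑ xs (g ∘ f)
  ∑-map f []       g = ≡.refl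
  ∑-map f (x ∷ xs) g = ≡.cong (_ +_) (∑-map f xs g)

  ∑-+ : ∀ (xs : List A) g h → ∑ xs (λ x → g x + h x) ≈ ∑ xs g + ∑ xs h
  ∑-+ []       g h = sym (+-identityˡ 0#)
  ∑-+ (x ∷ xs) g h = trans (+-congˡ (∑-+ xs g h))
    (solve 4 (λ s t u v → s :+ t :+ (u :+ v) := s :+ u :+ (t :+ v)) refl _ _ _ _)

  ∑-*ˡ : ∀ (xs : List A) w g → ∑ xs (λ x → w * g x) ≈ w * ∑ xs g
  ∑-*ˡ []       w g = sym (zeroʳ w)
  ∑-*ˡ (x ∷ xs) w g = trans (+-congˡ (∑-*ˡ xs w g)) (sym (distribˡ w _ _))

  ∑-const : ∀ (xs : List A) w → ∑ xs (const w) ≈ fromℕ (length xs) * w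
  ∑-const []       w = sym (zeroˡ w)
  ∑-const (x ∷ xs) w = trans (+-congˡ (∑-const xs w))
    (solve 2 (λ l w → w :+ l :* w := (:1 :+ l) :* w) refl (fromℕ (length xs)) w)

  ∑-≥-term : ∀ {xs : List A} {x} {g : A → Carrier} → (∀ y → 0# ≤ g y) → x ∈ˡ xs → g x ≤ ∑ xs g
  ∑-≥-term {xs = x ∷ xs} g≥0 (here ≡.refl) = x≤x+y (∑-nonneg xs g≥0)
  ∑-≥-term g≥0 (there x∈xs) = ≤-trans (∑-≥-term g≥0 x∈xs) (x≤y+x (g≥0 _))

  𝟙 : ∀ {p} {P : Set p} → Dec P → Carrier
  𝟙 P? = if does P? then 1# else 0#

  module _ {p} {P : Set p} (P? : Dec P) where

    𝟙-yes : P → 𝟙 P? ≡ 1#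
    𝟙-yes x = ≡.cong (if_then 1# else 0#) (dec-true P? x)

    𝟙-no : ¬ P → 𝟙 P? ≡ 0#
    𝟙-no x = ≡.cong (if_then 1# else 0#) (dec-false P? x)

    𝟙-nonneg : 0# ≤ 𝟙 P?
    𝟙-nonneg with does P?
    ... | true  = 0≤1
    ... | false = ≤-refl

    𝟙-≤1 : 𝟙 P? ≤ 1#
    𝟙-≤1 with does P?
    ... | true  = ≤-refl
    ... | false = 0≤1

    𝟙-¬ : 𝟙 (¬? P?) ≈ 1# - 𝟙 P?
    𝟙-¬ with does P?
    ... | true  = sym (-‿inverseʳ 1#)
    ... | false = solve 1 (λ a → a := a :- :0) refl 1#
  
  𝟙-≤ : ∀ {p} {P : Set p} (P? : Dec P) {x} → 0# ≤ x → (P → 1# ≤ x) → 𝟙 P? ≤ x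
  𝟙-≤ (yes Px) x≥0 x≥1 = x≥1 Px
  𝟙-≤ (no _)   x≥0 x≥1 = x≥0

  𝟙-cong : ∀ {p q} {P : Set p} {Q : Set q} (P? : Dec P) (Q? : Dec Q) →
           (P → Q) → (Q → P) → 𝟙 P? ≡ 𝟙 Q?
  𝟙-cong (yes Px) Q? to from = ≡.sym (𝟙-yes Q? (to Px))
  𝟙-cong (no ¬Px) Q? to from = ≡.sym (𝟙-no Q? (¬Px ∘ from))

  𝔼 : Dist A → (A → Carrier) → Carrier
  𝔼 D g = ∑ D (λ (w , x) → w * g x)

  Pr≈𝔼 : (D : Dist A) (P? : Decidable P) → Pr D P? ≈ 𝔼 D (λ x → 𝟙 (P? x))
  Pr≈𝔼 []            P? = refl
  Pr≈𝔼 ((w , x) ∷ D) P? = +-cong (weighted (does (P? x))) (Pr≈𝔼 D P?)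
    where
    weighted : ∀ d → (if d then w else 0#) ≈ w * (if d then 1# else 0#)
    weighted true  = sym (*-identityʳ w)
    weighted false = sym (zeroʳ w)

  𝔼-cong : ∀ (D : Dist A) {g h : A → Carrier} → (∀ x → g x ≈ h x) → 𝔼 D g ≈ 𝔼 D h
  𝔼-cong D eq = ∑-cong D (λ (w , x) → *-congˡ (eq x))

  𝔼-+ : ∀ (D : Dist A) g h → 𝔼 D (λ x → g x + h x) ≈ 𝔼 D g + 𝔼 D h
  𝔼-+ D g h = trans (∑-cong D (λ (w , x) → distribˡ w _ _)) (∑-+ D _ _)

  𝔼-*ˡ : ∀ (D : Dist A) u g → 𝔼 D (λ x → u * g x) ≈ u * 𝔼 D g
  𝔼-*ˡ D u g = trans
    (∑-cong D (λ (w , x) → solve 3 (λ w u g → w :* (u :* g) := u :* (w :* g)) refl w u (g x)))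
    (∑-*ˡ D u _)

  𝔼-0 : ∀ (D : Dist A) → 𝔼 D (const 0#) ≈ 0#
  𝔼-0 []            = refl
  𝔼-0 ((w , x) ∷ D) = trans (+-cong (zeroʳ w) (𝔼-0 D)) (+-identityˡ 0#)

  𝔼-∑ : ∀ (D : Dist A) (ys : List B) (g : B → A → Carrier) →
        𝔼 D (λ x → ∑ ys (λ y → g y x)) ≈ ∑ ys (λ y → 𝔼 D (g y))
  𝔼-∑ D []       g = 𝔼-0 D
  𝔼-∑ D (y ∷ ys) g = trans (𝔼-+ D _ _) (+-congˡ (𝔼-∑ D ys g))

  𝔼-return : ∀ (x : A) g → 𝔼 (return x) g ≈ g x
  𝔼-return x g = trans (+-identityʳ _) (*-identityˡ _)

  𝔼->>= : ∀ (D : Dist A) (f : A → Dist B) g → 𝔼 (D >>= f) g ≈ 𝔼 D (λ x → 𝔼 (f x) g)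
  𝔼->>= []            f g = refl
  𝔼->>= ((w , x) ∷ D) f g = begin-equality
    ∑ (scaled ++ (D >>= f)) (λ (w , x) → w * g x)
      ≈⟨ ∑-++ scaled (D >>= f) _ ⟩
    ∑ scaled (λ (w , x) → w * g x) + 𝔼 (D >>= f) g
      ≡⟨ ≡.cong (_+ _) (∑-map _ (f x) _) ⟩
    ∑ (f x) (λ (v , y) → w * v * g y) + 𝔼 (D >>= f) g
      ≈⟨ +-cong (trans (∑-cong (f x) (λ (v , y) → *-assoc w v (g y))) (∑-*ˡ (f x) w _))
                (𝔼->>= D f g) ⟩
    w * 𝔼 (f x) g + 𝔼 D (λ x → 𝔼 (f x) g)
      ∎
    where
    scaled = map (λ (v , y) → w * v , y) (f x)

  -- Weights of a `Dist` are unrestricted, so nonnegativity travels together with the property of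
  -- the outcomes; it is what makes `𝔼` monotone.
  Supported : Pred A p → Dist A → Set _
  Supported P = All (λ (w , x) → (0# ≤ w) × P x)

  Normalised : Dist A → Set _
  Normalised D = 𝔼 D (const 1#) ≈ 1#

  Supported-return : ∀ {x} → P x → Supported P (return x)
  Supported-return Px = (0≤1 , Px) ∷ []

  Supported->>= : ∀ {D : Dist A} {f : A → Dist B} → Supported P D →
                  (∀ x → P x → Supported Q (f x)) → Supported Q (D >>= f)
  Supported->>= []                  sf = []
  Supported->>= ((w≥0 , Px) ∷ sD) sf = All.++⁺
    (All.map⁺ (All.map (λ (v≥0 , Qy) → *-nonneg w≥0 v≥0 , Qy) (sf _ Px)))
    (Supported->>= sD sf)

  Normalised-return : ∀ (x : A) → Normalised (return x)
  Normalised-return x = 𝔼-return x _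

  Normalised->>= : ∀ (D : Dist A) {f : A → Dist B} → Normalised D → (∀ x → Normalised (f x)) →
                   Normalised (D >>= f)
  Normalised->>= D {f} nD nf = trans (𝔼->>= D f _) (trans (𝔼-cong D nf) nD)

  𝔼-mono : ∀ {D : Dist A} {g h : A → Carrier} → Supported P D → (∀ x → P x → g x ≤ h x) →
           𝔼 D g ≤ 𝔼 D h
  𝔼-mono sD g≤h = ∑-mono (All.map (λ (w≥0 , Px) → *-monoˡ-≤ w≥0 (g≤h _ Px)) sD)

  𝔼-cong-on : ∀ {D : Dist A} {g h : A → Carrier} → Supported P D → (∀ x → P x → g x ≈ h x) →
              𝔼 D g ≈ 𝔼 D h
  𝔼-cong-on []                g≈h = refl
  𝔼-cong-on ((_ , Px) ∷ sD) g≈h = +-cong (*-congˡ (g≈h _ Px)) (𝔼-cong-on sD g≈h)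

  𝔼-const : ∀ (D : Dist A) → Normalised D → ∀ u → 𝔼 D (const u) ≈ u
  𝔼-const D nD u = trans (𝔼-cong D (λ _ → sym (*-identityʳ u)))
    (trans (𝔼-*ˡ D u _) (trans (*-congˡ nD) (*-identityʳ u)))

  𝔼-nonneg : ∀ {D : Dist A} {g : A → Carrier} → Supported P D → (∀ x → 0# ≤ g x) → 0# ≤ 𝔼 D g
  𝔼-nonneg {D = D} sD g≥0 = ≤-trans (≤-reflexive (sym (𝔼-0 D))) (𝔼-mono sD (λ x _ → g≥0 x))

  𝔼-≤1 : ∀ {D : Dist A} {g : A → Carrier} → Supported P D → Normalised D → (∀ x → g x ≤ 1#) →
         𝔼 D g ≤ 1#
  𝔼-≤1 sD nD g≤1 = ≤-trans (𝔼-mono sD (λ x _ → g≤1 x)) (≤-reflexive nD)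

  𝔼-complement : ∀ (D : Dist A) g → Normalised D → 𝔼 D (λ x → 1# - g x) ≈ 1# - 𝔼 D g
  𝔼-complement D g nD = begin-equality
    𝔼 D (λ x → 1# - g x)
      ≈⟨ solve 2 (λ a b → a := a :+ b :- b) refl (𝔼 D (λ x → 1# - g x)) (𝔼 D g) ⟩
    𝔼 D (λ x → 1# - g x) + 𝔼 D g - 𝔼 D g
      ≈⟨ +-congʳ (𝔼-+ D _ g) ⟨
    𝔼 D (λ x → 1# - g x + g x) - 𝔼 D g
      ≈⟨ +-congʳ (𝔼-cong D (λ x → solve 2 (λ a b → a :- b :+ b := a) refl 1# (g x))) ⟩
    𝔼 D (const 1#) - 𝔼 D g
      ≈⟨ +-congʳ nD ⟩
    1# - 𝔼 D g
      ∎

  weight : ∀ m .{{_ : NonZero m}} → Carrier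
  weight m = recip (fromℕ m) (fromℕ-pos m)

  weight-nonneg : ∀ m .{{_ : NonZero m}} → 0# ≤ weight m
  weight-nonneg m = <⇒≤ (recip-pos (fromℕ m) (fromℕ-pos m))

  data Drawn {A : Set a} (xs : List A) : Maybe A → Set a where
    drawn   : ∀ {x} → x ∈ˡ xs → Drawn xs (just x)
    nothing : Drawn xs nothing

  Supported-uniform : (xs : List A) → Supported (Drawn xs) (uniform xs)
  Supported-uniform []          = Supported-return nothing
  Supported-uniform xs@(_ ∷ ys) = All.map⁺ (All.tabulate (λ x∈xs →
    weight-nonneg (suc (length ys)) , drawn x∈xs))

  Normalised-uniform : (xs : List A) → Normalised (uniform xs)
  Normalised-uniform {A = A} []  = Normalised-return {A = Maybe A} nothing
  Normalised-uniform xs@(_ ∷ ys) = begin-equality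
    𝔼 (uniform xs) (const 1#)         ≡⟨ ∑-map _ xs _ ⟩
    ∑ xs (const (weight l * 1#))      ≈⟨ ∑-const xs _ ⟩
    fromℕ l * (weight l * 1#)         ≈⟨ *-congˡ (*-identityʳ _) ⟩
    fromℕ l * weight l                ≈⟨ *-recip _ _ ⟩
    1#                                ∎
    where l = suc (length ys)

  -- The outcome `x` alone contributes `g (just x)` divided by the length, and the others only add
  -- to it. Multiplying by the length keeps reciprocals out of the products of thresholds.
  𝔼-uniform-≥ : ∀ {xs : List A} {x} {g : Maybe A → Carrier} → (∀ y → 0# ≤ g y) → x ∈ˡ xs →
                g (just x) ≤ 𝔼 (uniform xs) g * fromℕ (length xs)
  𝔼-uniform-≥ {xs = xs@(_ ∷ ys)} {x} {g} g≥0 x∈xs = begin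
    g (just x)                              ≈⟨ *-identityˡ _ ⟨
    1# * g (just x)                         ≈⟨ *-congʳ (*-recip _ _) ⟨
    fromℕ l * weight l * g (just x)         ≈⟨ solve 3 (λ l w g → l :* w :* g := w :* g :* l) refl _ _ _ ⟩
    weight l * g (just x) * fromℕ l         ≤⟨ *-monoʳ-≤ (fromℕ-nonneg l)
      (∑-≥-term (λ y → *-nonneg (weight-nonneg l) (g≥0 (just y))) x∈xs) ⟩
    ∑ xs (λ y → weight l * g (just y)) * fromℕ l  ≡⟨ ≡.cong (_* fromℕ l) (∑-map _ xs _) ⟨
    𝔼 (uniform xs) g * fromℕ l              ∎
    where l = suc (length ys)

-- The algorithm on a fixed hypergraph

module Algorithm {c ℓ₁ ℓ₂} (R : RealNumbers c ℓ₁ ℓ₂) {n : ℕ} (k r : ℕ) (r<k : r ℕ.< k) (G : Hypergraph n) where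
  open FiniteSets
  open RealNumbers R
  open GreedyRandomSampling R
  open RealFacts R
  open Expectation R
  open ≤-Reasoning
  open IntegerRingSolver commutativeRing using (solve; :0; :1; _:+_; _:*_; _:-_; :-_; _:=_)

  open Cliques r G

  private
    s = suc r

    k-r+r≡k : k ∸ r ℕ.+ r ≡ k
    k-r+r≡k = ℕ.m∸n+n≡m (ℕ.<⇒≤ r<k)

  Sound : Maybe (List (Fin n)) → Set
  Sound result = ∀ vs → result ≡ just vs → IsClique s G k (toSubset vs)

  -- The invariant is that the `i` vertices chosen so far form a clique and `j` more are to come, so
  -- a completed iteration ends with a `k`-clique.
  Supported-extend : ∀ j {i vs} → j ℕ.+ i ≡ k → IsClique s G i (toSubset vs) →
                     Supported Sound (extend k s G j vs)
  Supported-extend zero    ≡.refl clique = Supported-return λ { _ ≡.refl → clique }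
  Supported-extend (suc j) {i} {vs} eq clique = Supported->>= (Supported-uniform (CN s G (toSubset vs))) λ where
    nothing  _          → Supported-return λ _ ()
    (just v) (drawn v∈) → Supported-extend j (≡.trans (ℕ.+-suc j i) eq)
      (≡.subst (IsClique s G (suc i)) (≡.sym (toSubset-∷ v vs))
        (clique-extend clique (proj₂ (∈.∈-filter⁻ (isCommonNeighbour? s G (toSubset vs)) {xs = allFin n} v∈))))

  Supported-sample : Supported Sound (sampleVertices k s G)
  Supported-sample = Supported->>= (Supported-uniform (distinctTuples n r)) λ where
    nothing   _           → Supported-return λ _ ()
    (just vs) (drawn vs∈) → Supported-extend (k ∸ r) k-r+r≡k (clique-start vs∈)

  -- Separate from `Supported-extend` because it is applied to `v ∷ vs` for arbitrary `v`, where the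
  -- list need not be a clique.
  Nonnegative-extend : ∀ j vs → Supported U (extend k s G j vs)
  Nonnegative-extend zero    vs = Supported-return _
  Nonnegative-extend (suc j) vs = Supported->>= (Supported-uniform (CN s G (toSubset vs))) λ where
    nothing  _ → Supported-return _
    (just v) _ → Nonnegative-extend j (v ∷ vs)

  Normalised-extend : ∀ j vs → Normalised (extend k s G j vs)
  Normalised-extend zero    vs = Normalised-return {A = Maybe _} (just vs)
  Normalised-extend (suc j) vs = Normalised->>= (uniform (CN s G (toSubset vs)))
    (Normalised-uniform (CN s G (toSubset vs))) λ where
    nothing  → Normalised-return {A = Maybe (List (Fin n))} nothing
    (just v) → Normalised-extend j (v ∷ vs)

  Normalised-sample : Normalised (sampleVertices k s G)
  Normalised-sample = Normalised->>= (uniform (distinctTuples n r)) (Normalised-uniform (distinctTuples n r)) λ where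
    nothing   → Normalised-return {A = Maybe (List (Fin n))} nothing
    (just vs) → Normalised-extend (k ∸ r) vs

  hit : Subset n → Maybe (List (Fin n)) → Carrier
  hit W nothing   = 0#
  hit W (just vs) = 𝟙 (toSubset vs ≟ˢ W)

  hit-nonneg : ∀ W result → 0# ≤ hit W result
  hit-nonneg W nothing   = ≤-refl
  hit-nonneg W (just vs) = 𝟙-nonneg (toSubset vs ≟ˢ W)

  hit-≤1 : ∀ W result → hit W result ≤ 1#
  hit-≤1 W nothing   = 0≤1
  hit-≤1 W (just vs) = 𝟙-≤1 (toSubset vs ≟ˢ W)

  ℙhit : Subset n → Carrier
  ℙhit W = 𝔼 (sampleVertices k s G) (hit W)

  ℙhit-≤1 : ∀ W → ℙhit W ≤ 1#
  ℙhit-≤1 W = 𝔼-≤1 Supported-sample Normalised-sample (hit-≤1 W)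

  missing : Subset n → List (Subset n) → Carrier
  missing W S = 𝟙 (¬? (W ∈? S))

  add : Maybe (List (Fin n)) → List (Subset n) → List (Subset n)
  add = addResult k s G

  ∈-add : ∀ {W} result {S} → W ∈ S → W ∈ add result S
  ∈-add nothing   W∈S = W∈S
  ∈-add (just vs) {S} W∈S with toSubset vs ∈? S
  ... | yes _ = W∈S
  ... | no  _ = there W∈S

  toSubset-∈-add : ∀ vs S → toSubset vs ∈ add (just vs) S
  toSubset-∈-add vs S with toSubset vs ∈? S
  ... | yes vs∈S = vs∈S
  ... | no  _    = here ≡.refl

  missing-add : ∀ W result S → missing W (add result S) ≤ missing W S * (1# - hit W result)
  missing-add W result S with W ∈? add result S
  ... | yes _ = *-nonneg (𝟙-nonneg (¬? (W ∈? S))) (x≤y⇒0≤y-x (hit-≤1 W result))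
  ... | no W∉ = ≤-reflexive (sym (trans (*-cong
      (reflexive (𝟙-yes (¬? (W ∈? S)) (λ W∈S → W∉ (∈-add result W∈S))))
      (trans (+-congˡ (-‿cong (no-hit result W∉))) (solve 0 (:1 :- :0 := :1) refl)))
      (*-identityˡ 1#)))
    where
    no-hit : ∀ result → ¬ (W ∈ add result S) → hit W result ≈ 0#
    no-hit nothing   W∉ = refl
    no-hit (just vs) W∉ = reflexive (𝟙-no (toSubset vs ≟ˢ W) λ { ≡.refl → W∉ (toSubset-∈-add vs S) })

  -- For a fixed `G`, the sampled vertices do not depend on the current list, so every iteration
  -- contributes the same independent factor `1# - ℙhit W`.
  𝔼-missing : ∀ W t S → 𝔼 (iterate k s G t S) (missing W) ≤ missing W S * (1# - ℙhit W) ^ t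
  𝔼-missing W zero    S = ≤-reflexive (trans (𝔼-return S (missing W)) (sym (*-identityʳ _)))
  𝔼-missing W (suc t) S = begin
    𝔼 (sampleVertices k s G >>= λ result → iterate k s G t (add result S)) (missing W)
      ≈⟨ 𝔼->>= (sampleVertices k s G) _ _ ⟩
    𝔼 (sampleVertices k s G) (λ result → 𝔼 (iterate k s G t (add result S)) (missing W))
      ≤⟨ 𝔼-mono Supported-sample (λ result _ → step result) ⟩
    𝔼 (sampleVertices k s G) (λ result → missing W S * (1# - ℙhit W) ^ t * (1# - hit W result))
      ≈⟨ 𝔼-*ˡ (sampleVertices k s G) _ _ ⟩
    missing W S * (1# - ℙhit W) ^ t * 𝔼 (sampleVertices k s G) (λ result → 1# - hit W result)
      ≈⟨ *-congˡ (𝔼-complement (sampleVertices k s G) (hit W) Normalised-sample) ⟩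
    missing W S * (1# - ℙhit W) ^ t * (1# - ℙhit W)
      ≈⟨ solve 3 (λ a b d → a :* b :* d := a :* (d :* b)) refl _ _ _ ⟩
    missing W S * (1# - ℙhit W) ^ suc t
      ∎
    where
    step : ∀ result → 𝔼 (iterate k s G t (add result S)) (missing W)
                      ≤ missing W S * (1# - ℙhit W) ^ t * (1# - hit W result)
    step result = begin
      𝔼 (iterate k s G t (add result S)) (missing W)
        ≤⟨ 𝔼-missing W t (add result S) ⟩
      missing W (add result S) * (1# - ℙhit W) ^ t
        ≤⟨ *-monoʳ-≤ (^-nonneg (x≤y⇒0≤y-x (ℙhit-≤1 W)) t) (missing-add W result S) ⟩
      missing W S * (1# - hit W result) * (1# - ℙhit W) ^ t
        ≈⟨ solve 3 (λ a b d → a :* b :* d := a :* d :* b) refl _ _ _ ⟩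
      missing W S * (1# - ℙhit W) ^ t * (1# - hit W result)
        ∎

  AllCliques : List (Subset n) → Set
  AllCliques S = ∀ W → W ∈ S → IsClique s G k W

  AllCliques-add : ∀ result {S} → Sound result → AllCliques S → AllCliques (add result S)
  AllCliques-add nothing   sound cliques = cliques
  AllCliques-add (just vs) {S} sound cliques with toSubset vs ∈? S
  ... | yes _ = cliques
  ... | no  _ = λ { W (here ≡.refl) → sound vs ≡.refl ; W (there W∈S) → cliques W W∈S }

  Supported-iterate : ∀ t {S} → AllCliques S → Supported AllCliques (iterate k s G t S)
  Supported-iterate zero    cliques = Supported-return cliques
  Supported-iterate (suc t) cliques = Supported->>= Supported-sample λ result sound →
    Supported-iterate t (AllCliques-add result sound cliques)

  Normalised-iterate : ∀ t S → Normalised (iterate k s G t S)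
  Normalised-iterate zero    S = Normalised-return S
  Normalised-iterate (suc t) S = Normalised->>= (sampleVertices k s G) Normalised-sample λ result →
    Normalised-iterate t (add result S)

  -- S lists only cliques, so it can only differ from cl_k(G) by missing a clique.
  failure-≤ : ∀ S → AllCliques S → 𝟙 (¬? (isCliqueSet? s G k S)) ≤
    ∑ (subsetsOf ⊤ k) (λ W → 𝟙 (isClique? s G k W) * missing W S)
  failure-≤ S cliques = 𝟙-≤ (¬? (isCliqueSet? s G k S)) (∑-nonneg (subsetsOf ⊤ k) term≥0)
    λ ¬all sum<1 → ¬all λ W → cliques W , λ clique → decidable-stable (W ∈? S) λ W∉S →
      ≤-trans (≤-reflexive (sym (trans (*-cong (reflexive (𝟙-yes (isClique? s G k W) clique))
                                               (reflexive (𝟙-yes (¬? (W ∈? S)) W∉S))) (*-identityˡ 1#))))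
        (∑-≥-term term≥0
          (≡.subst (λ l → W ∈ˡ subsetsOf ⊤ l) (proj₁ clique) (∈-subsetsOf-⊤ W)))
        sum<1
    where
    term≥0 : ∀ W → 0# ≤ 𝟙 (isClique? s G k W) * missing W S
    term≥0 W = *-nonneg (𝟙-nonneg (isClique? s G k W)) (𝟙-nonneg (¬? (W ∈? S)))

  ℙfailure : ℕ → Carrier
  ℙfailure T = 𝔼 (greedyRandomSampling k s G T) (λ S → 𝟙 (¬? (isCliqueSet? s G k S)))

  -- The indicator of being a clique is kept because `ℙhit W` has a useful lower bound only for
  -- cliques.
  ℙfailure-≤ : ∀ T → ℙfailure T ≤ ∑ (subsetsOf ⊤ k) (λ W → 𝟙 (isClique? s G k W) * (1# - ℙhit W) ^ T)
  ℙfailure-≤ T = begin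
    ℙfailure T
      ≤⟨ 𝔼-mono (Supported-iterate T (λ _ ())) failure-≤ ⟩
    𝔼 D (λ S → ∑ Ws (λ W → 𝟙 (isClique? s G k W) * missing W S))
      ≈⟨ 𝔼-∑ D Ws _ ⟩
    ∑ Ws (λ W → 𝔼 D (λ S → 𝟙 (isClique? s G k W) * missing W S))
      ≈⟨ ∑-cong Ws (λ W → 𝔼-*ˡ D _ (missing W)) ⟩
    ∑ Ws (λ W → 𝟙 (isClique? s G k W) * 𝔼 D (missing W))
      ≤⟨ ∑-mono (All.universal (λ W → *-monoˡ-≤ (𝟙-nonneg (isClique? s G k W))
           (≤-trans (𝔼-missing W T []) (≤-reflexive (*-identityˡ _)))) Ws) ⟩
    ∑ Ws (λ W → 𝟙 (isClique? s G k W) * (1# - ℙhit W) ^ T)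
      ∎
    where
    D  = greedyRandomSampling k s G T
    Ws = subsetsOf {n} ⊤ k

  ℙfailure-≤1 : ∀ T → ℙfailure T ≤ 1#
  ℙfailure-≤1 T = 𝔼-≤1 (Supported-iterate T (λ _ ())) (Normalised-iterate T [])
    (λ S → 𝟙-≤1 (¬? (isCliqueSet? s G k S)))

  module _ (m : ℕ → Carrier) (m≥0 : ∀ i → 0# ≤ m i)
           (CN≤m : ∀ A → ∣ A ∣ ℕ.< k → fromℕ (length (CN s G A)) ≤ m ∣ A ∣) where

    -- While the chosen vertices lie in `W`, some further vertex of `W` is among the common
    -- neighbours, and it is drawn with probability at least the reciprocal of `m i`. The induction
    -- multiplies these reciprocals, moved to the other side as `∏ m i j`.
    ℙextend-≥ : ∀ {W} → IsClique s G k W → ∀ j {i vs} → j ℕ.+ i ≡ k → ∣ toSubset vs ∣ ≡ i → toSubset vs ⊆ˢ W →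
                1# ≤ 𝔼 (extend k s G j vs) (hit W) * ∏ m i j
    ℙextend-≥ {W} (∣W∣ , _) zero {vs = vs} ≡.refl ∣vs∣ vs⊆W = ≤-reflexive (sym (trans (*-identityʳ _)
      (trans (𝔼-return {A = Maybe _} (just vs) (hit W))
        (reflexive (𝟙-yes (toSubset vs ≟ˢ W) (⊆-∣∣-≡ vs⊆W (≡.trans ∣vs∣ (≡.sym ∣W∣))))))))
    ℙextend-≥ {W} clique@(∣W∣ , _) (suc j) {i} {vs} eq ∣vs∣ vs⊆W with ∃-∈-∉ vs<W
      where
      vs<W : ∣ toSubset vs ∣ ℕ.< ∣ W ∣
      vs<W = ≡.subst₂ ℕ._<_ (≡.sym ∣vs∣) (≡.trans eq (≡.sym ∣W∣)) (ℕ.s≤s (ℕ.m≤n+m i j))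
    ... | v , v∈W , v∉vs = begin
      1#
        ≤⟨ ℙextend-≥ clique j (≡.trans (ℕ.+-suc j i) eq) ∣v∷vs∣ (toSubset-∷-⊆ {vs = vs} v∈W vs⊆W) ⟩
      g (just v) * Π
        ≤⟨ *-monoʳ-≤ Π≥0 (𝔼-uniform-≥ {xs = CN s G (toSubset vs)} {g = g} g≥0 (clique-neighbour clique vs⊆W v∈W v∉vs)) ⟩
      𝔼 (uniform (CN s G (toSubset vs))) g * fromℕ (length (CN s G (toSubset vs))) * Π
        ≤⟨ *-monoʳ-≤ Π≥0 (*-monoˡ-≤ (𝔼-nonneg (Supported-uniform (CN s G (toSubset vs))) g≥0) CN≤) ⟩
      𝔼 (uniform (CN s G (toSubset vs))) g * m i * Π
        ≈⟨ *-assoc _ _ _ ⟩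
      𝔼 (uniform (CN s G (toSubset vs))) g * (m i * Π)
        ≈⟨ *-congʳ (trans (𝔼->>= (uniform (CN s G (toSubset vs))) _ (hit W))
             (𝔼-cong (uniform (CN s G (toSubset vs))) {h = g} λ where
           nothing  → 𝔼-return {A = Maybe (List (Fin n))} nothing (hit W)
           (just v) → refl)) ⟨
      𝔼 (extend k s G (suc j) vs) (hit W) * (m i * Π)
        ∎
      where
      Π = ∏ m (suc i) j

      Π≥0 : 0# ≤ Π
      Π≥0 = ∏-nonneg m≥0 (suc i) j

      g : Maybe (Fin n) → Carrier
      g nothing  = 0#
      g (just v) = 𝔼 (extend k s G j (v ∷ vs)) (hit W)

      g≥0 : ∀ x → 0# ≤ g x
      g≥0 nothing  = ≤-refl
      g≥0 (just v) = 𝔼-nonneg (Nonnegative-extend j (v ∷ vs)) (hit-nonneg W)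

      ∣v∷vs∣ : ∣ toSubset (v ∷ vs) ∣ ≡ suc i
      ∣v∷vs∣ = ≡.trans (≡.cong ∣_∣ (toSubset-∷ v vs)) (≡.trans (∣A∪⁅v⁆∣ _ v∉vs) (≡.cong suc ∣vs∣))

      CN≤ : fromℕ (length (CN s G (toSubset vs))) ≤ m i
      CN≤ = ≡.subst (λ l → fromℕ (length (CN s G (toSubset vs))) ≤ m l) ∣vs∣
        (CN≤m (toSubset vs) (≡.subst₂ ℕ._≤_ (≡.cong suc (≡.sym ∣vs∣)) eq (ℕ.s≤s (ℕ.m≤n+m i j))))

    -- Only one ordering of the vertices of `W` is followed. Counting all orderings would improve
    -- this bound by no more than the constant factor k!.
    ℙhit-≥ : ∀ {W} → IsClique s G k W → 1# ≤ ℙhit W * (fromℕ n ^ r * ∏ m r (k ∸ r))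
    ℙhit-≥ {W} clique@(∣W∣ , _) with ∃-distinctTuple-⊆ W r (≡.subst (r ℕ.≤_) (≡.sym ∣W∣) (ℕ.<⇒≤ r<k))
    ... | vs , unique , length≡r , vs⊆W = begin
      1#
        ≤⟨ ℙextend-≥ clique (k ∸ r) k-r+r≡k (≡.trans (∣toSubset∣ unique) length≡r) vs⊆W ⟩
      g (just vs) * Π
        ≤⟨ *-monoʳ-≤ Π≥0 (𝔼-uniform-≥ {xs = starts} {g = g} g≥0 vs∈) ⟩
      𝔼 (uniform starts) g * fromℕ (length starts) * Π
        ≤⟨ *-monoʳ-≤ Π≥0 (*-monoˡ-≤ (𝔼-nonneg (Supported-uniform starts) g≥0)
             (≤-trans (fromℕ-mono-≤ (length-distinctTuples n r)) (≤-reflexive (fromℕ-^ n r)))) ⟩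
      𝔼 (uniform starts) g * fromℕ n ^ r * Π
        ≈⟨ *-assoc _ _ _ ⟩
      𝔼 (uniform starts) g * (fromℕ n ^ r * Π)
        ≈⟨ *-congʳ (trans (𝔼->>= (uniform starts) _ (hit W)) (𝔼-cong (uniform starts) {h = g} λ where
             nothing   → 𝔼-return {A = Maybe (List (Fin n))} nothing (hit W)
             (just vs) → refl)) ⟨
      ℙhit W * (fromℕ n ^ r * Π)
        ∎
      where
      starts = distinctTuples n r

      vs∈ : vs ∈ˡ starts
      vs∈ = ≡.subst (λ l → vs ∈ˡ distinctTuples n l) length≡r (∈-distinctTuples⁺ unique)

      Π      = ∏ m r (k ∸ r)

      Π≥0 : 0# ≤ Π
      Π≥0 = ∏-nonneg m≥0 r (k ∸ r)

      g : Maybe (List (Fin n)) → Carrier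
      g nothing   = 0#
      g (just vs) = 𝔼 (extend k s G (k ∸ r) vs) (hit W)

      g≥0 : ∀ x → 0# ≤ g x
      g≥0 nothing   = ≤-refl
      g≥0 (just vs) = 𝔼-nonneg (Nonnegative-extend (k ∸ r) vs) (hit-nonneg W)

-- Moments of common neighbourhoods

module RandomHypergraph {c ℓ₁ ℓ₂} (R : RealNumbers c ℓ₁ ℓ₂) where
  open FiniteSets
  open RealNumbers R
  open GreedyRandomSampling R
  open RealFacts R
  open Expectation R
  open ≤-Reasoning
  open IntegerRingSolver commutativeRing using (solve; :0; :1; _:+_; _:*_; _:-_; :-_; _:=_)

  -- The indicator that all of `H` is present, taken as a product so that concatenating lists of
  -- edges becomes multiplication.
  included : ∀ {n} → List (Subset n) → Hypergraph n → Carrier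
  included []      G = 1#
  included (B ∷ H) G = 𝟙 (B ∈? G) * included H G

  module _ {n : ℕ} where

    included-++ : ∀ H F (G : Hypergraph n) → included (H ++ F) G ≈ included H G * included F G
    included-++ []      F G = sym (*-identityˡ _)
    included-++ (B ∷ H) F G = trans (*-congˡ (included-++ H F G)) (sym (*-assoc _ _ _))

    included-middle : ∀ H {B} F (G : Hypergraph n) →
                      included (H ++ B ∷ F) G ≈ 𝟙 (B ∈? G) * included (H ++ F) G
    included-middle H {B} F G = trans (included-++ H (B ∷ F) G)
      (trans (solve 3 (λ h b f → h :* (b :* f) := b :* (h :* f)) refl _ _ _)
             (*-congˡ (sym (included-++ H F G))))

    included-nonneg : ∀ H (G : Hypergraph n) → 0# ≤ included H G
    included-nonneg []      G = 0≤1
    included-nonneg (B ∷ H) G = *-nonneg (𝟙-nonneg (B ∈? G)) (included-nonneg H G)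

    included-all : ∀ {H} {G : Hypergraph n} → All (_∈ G) H → included H G ≈ 1#
    included-all []                     = refl
    included-all {B ∷ _} {G} (B∈ ∷ H∈) =
      trans (*-cong (reflexive (𝟙-yes (B ∈? G) B∈)) (included-all H∈)) (*-identityˡ 1#)

    included-∷ : ∀ {H B} (G : Hypergraph n) → B ∉ˡ H → included H (B ∷ G) ≈ included H G
    included-∷ {[]}    G B∉ = refl
    included-∷ {D ∷ H} {B} G B∉ = *-cong (reflexive same) (included-∷ G (B∉ ∘ there))
      where
      same : 𝟙 (D ∈? (B ∷ G)) ≡ 𝟙 (D ∈? G)
      same = 𝟙-cong (D ∈? (B ∷ G)) (D ∈? G)
        (λ { (here D≡B) → contradiction (here (≡.sym D≡B)) B∉ ; (there D∈G) → D∈G }) there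

  module _ {q : Carrier} (q≥0 : 0# ≤ q) (q≤1 : q ≤ 1#) where

    private
      keepOrDrop : ∀ {a} {A : Set a} → A → List A → Dist (List A)
      keepOrDrop x ys = (q , x ∷ ys) ∷ (1# - q , ys) ∷ []

    𝔼-randomSublist-∷ : ∀ {a} {A : Set a} (x : A) L g → 𝔼 (randomSublist q (x ∷ L)) g ≈
      𝔼 (randomSublist q L) (λ ys → q * g (x ∷ ys) + ((1# - q) * g ys + 0#))
    𝔼-randomSublist-∷ x L g = 𝔼->>= (randomSublist q L) (keepOrDrop x) g

    Supported-randomSublist : ∀ {a} {A : Set a} (L : List A) → Supported (All (_∈ˡ L)) (randomSublist q L)
    Supported-randomSublist []      = Supported-return []
    Supported-randomSublist (x ∷ L) = Supported->>= {f = keepOrDrop x} (Supported-randomSublist L) λ ys ys⊆L →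
      (q≥0 , here ≡.refl ∷ All.map there ys⊆L) ∷ (x≤y⇒0≤y-x q≤1 , All.map there ys⊆L) ∷ []

    Normalised-randomSublist : ∀ {a} {A : Set a} (L : List A) → Normalised (randomSublist q L)
    Normalised-randomSublist {A = A} []      = Normalised-return {A = List A} []
    Normalised-randomSublist (x ∷ L) = Normalised->>= (randomSublist q L) {keepOrDrop x} (Normalised-randomSublist L)
      λ ys → solve 1 (λ q → q :* :1 :+ ((:1 :- q) :* :1 :+ :0)
                            := :1) refl q

    -- Condition on the first potential edge `B` of `L`. If `B` is not in `H`, keeping or dropping
    -- it makes no difference. If it is, dropping it gives zero, since `B` does not recur in `L`,
    -- and keeping it gives a factor `q` and removes `B` from `H`.
    𝔼-included : ∀ {n} {L H : List (Subset n)} → Unique L → Unique H → All (_∈ˡ L) H →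
                 𝔼 (randomSublist q L) (included H) ≈ q ^ length H
    𝔼-included {n} {L = []} {[]} uL uH H⊆L = 𝔼-return {A = Hypergraph n} [] (included [])
    𝔼-included {L = []} {_ ∷ _} uL uH (() ∷ _)
    𝔼-included {L = B ∷ L} {H} uL@(_ ∷ uL′) uH H⊆L with B ∈? H
    ... | no B∉H = begin-equality
      𝔼 (randomSublist q (B ∷ L)) (included H)
        ≈⟨ 𝔼-randomSublist-∷ B L (included H) ⟩
      𝔼 (randomSublist q L) (λ G → q * included H (B ∷ G) + ((1# - q) * included H G + 0#))
        ≈⟨ 𝔼-cong (randomSublist q L) (λ G → trans (+-congʳ (*-congˡ (included-∷ G B∉H)))
             (trans (solve 3 (λ q o x → q :* x :+ ((o :- q) :* x :+ :0) := o :* x) refl q 1# _)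
                    (*-identityˡ _))) ⟩
      𝔼 (randomSublist q L) (included H)
        ≈⟨ 𝔼-included uL′ uH (All.zipWith shrink (H⊆L , All.¬Any⇒All¬ H B∉H)) ⟩
      q ^ length H
        ∎
      where
      shrink : ∀ {D} → (D ∈ˡ B ∷ L) × (B ≢ D) → D ∈ˡ L
      shrink (here D≡B , B≢D) = contradiction (≡.sym D≡B) B≢D
      shrink (there D∈ , _)   = D∈
    ... | yes B∈H with ∈.∈-∃++ B∈H
    ...   | H₁ , H₂ , ≡.refl = begin-equality
      𝔼 (randomSublist q (B ∷ L)) (included (H₁ ++ B ∷ H₂))
        ≈⟨ 𝔼-randomSublist-∷ B L (included (H₁ ++ B ∷ H₂)) ⟩
      𝔼 (randomSublist q L) (λ G → q * included (H₁ ++ B ∷ H₂) (B ∷ G) + ((1# - q) * included (H₁ ++ B ∷ H₂) G + 0#))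
        ≈⟨ 𝔼-cong-on (Supported-randomSublist L) pointwise ⟩
      𝔼 (randomSublist q L) (λ G → q * included (H₁ ++ H₂) G)
        ≈⟨ 𝔼-*ˡ (randomSublist q L) q _ ⟩
      q * 𝔼 (randomSublist q L) (included (H₁ ++ H₂))
        ≈⟨ *-congˡ (𝔼-included uL′ (AllPairs.tail uH′) (All.zipWith shrink (All.tail H⊆L′ , AllPairs.head uH′))) ⟩
      q ^ suc (length (H₁ ++ H₂))
        ≈⟨ ^-≡ q (≡.sym (↭.↭-length (↭.shift B H₁ H₂))) ⟩
      q ^ length (H₁ ++ B ∷ H₂)
        ∎
      where
      shrink : ∀ {D} → (D ∈ˡ B ∷ L) × (B ≢ D) → D ∈ˡ L
      shrink (here D≡B , B≢D) = contradiction (≡.sym D≡B) B≢D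
      shrink (there D∈ , _)   = D∈

      uH′ : Unique (B ∷ H₁ ++ H₂)
      uH′ = Unique-resp-↭ (↭.shift B H₁ H₂) uH

      H⊆L′ : All (_∈ˡ B ∷ L) (B ∷ H₁ ++ H₂)
      H⊆L′ = ↭.All-resp-↭ (↭.shift B H₁ H₂) H⊆L

      pointwise : ∀ G → All (_∈ˡ L) G →
        q * included (H₁ ++ B ∷ H₂) (B ∷ G) + ((1# - q) * included (H₁ ++ B ∷ H₂) G + 0#) ≈ q * included (H₁ ++ H₂) G
      pointwise G G⊆L = trans
        (+-cong
          (*-congˡ (trans (included-middle H₁ H₂ (B ∷ G))
            (trans (*-cong (reflexive (𝟙-yes (B ∈? (B ∷ G)) (here ≡.refl)))
                           (included-∷ G (Unique.Unique[x∷xs]⇒x∉xs uH′)))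
                   (*-identityˡ _))))
          (+-congʳ (*-congˡ (trans (included-middle H₁ H₂ G)
            (*-congʳ (reflexive (𝟙-no (B ∈? G) λ B∈G →
              Unique.Unique[x∷xs]⇒x∉xs uL (All.lookup G⊆L B∈G))))))))
        (solve 4 (λ q o x y → q :* x :+ ((o :- q) :* (:0 :* y) :+ :0) := q :* x)
          refl q 1# _ (included (H₁ ++ H₂) G))

    module _ {n : ℕ} (L : List (Subset n)) (uL : Unique L) {X : Set} (F : X → List (Subset n))
             (f : ℕ) (length-F : ∀ v → length (F v) ≡ f) (z : Carrier) where

      -- An indicator x satisfies 1 + z x = (1 + z)^x, so this product is 1 + z raised to the number
      -- of `v` in the list whose edges are all present: the integrand of a moment generating
      -- function, in a form that is multilinear in the indicators.
      factors : List X → Hypergraph n → Carrier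
      factors []       G = 1#
      factors (v ∷ vs) G = (1# + z * included (F v) G) * factors vs G

      -- Expanding the first factor moves its edges into H; the two terms are then
      -- expectations of the same form.
      𝔼-factors : ∀ vs H → Unique (H ++ concatMap F vs) → All (_∈ˡ L) (H ++ concatMap F vs) →
        𝔼 (randomSublist q L) (λ G → included H G * factors vs G)
        ≈ q ^ length H * (1# + z * q ^ f) ^ length vs
      𝔼-factors [] H u ⊆L = trans (𝔼-cong (randomSublist q L) (λ G → *-identityʳ _))
        (trans (𝔼-included uL (≡.subst Unique (List.++-identityʳ H) u)
                              (≡.subst (All (_∈ˡ L)) (List.++-identityʳ H) ⊆L))
               (sym (*-identityʳ _)))
      𝔼-factors (v ∷ vs) H u ⊆L = begin-equality
        𝔼 D (λ G → included H G * factors (v ∷ vs) G)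
          ≈⟨ 𝔼-cong D (λ G → trans
               (trans (*-congˡ (*-congʳ (+-congʳ (sym (*-identityˡ 1#)))))
                 (solve 5 (λ o h z i p → h :* ((o :* o :+ z :* i) :* p)
                                         := o :* o :* (h :* p) :+ z :* ((h :* i) :* p))
                    refl 1# (included H G) z (included (F v) G) (factors vs G)))
               (+-cong (trans (*-congʳ (*-identityˡ 1#)) (*-identityˡ _))
                       (*-congˡ (*-congʳ (sym (included-++ H (F v) G)))))) ⟩
        𝔼 D (λ G → included H G * factors vs G + z * (included (H ++ F v) G * factors vs G))
          ≈⟨ trans (𝔼-+ D _ _) (+-congˡ (𝔼-*ˡ D z _)) ⟩
        𝔼 D (λ G → included H G * factors vs G) + z * 𝔼 D (λ G → included (H ++ F v) G * factors vs G)
          ≈⟨ +-cong (𝔼-factors vs H drop-u drop-⊆)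
               (*-congˡ (𝔼-factors vs (H ++ F v) (≡.subst Unique assoc u) (≡.subst (All (_∈ˡ L)) assoc ⊆L))) ⟩
        q ^ length H * y + z * (q ^ length (H ++ F v) * y)
          ≈⟨ +-congˡ (*-congˡ (*-congʳ (trans
               (^-≡ q (≡.trans (List.length-++ H) (≡.cong (length H ℕ.+_) (length-F v))))
               (^-homo-* q (length H) f)))) ⟩
        q ^ length H * y + z * (q ^ length H * q ^ f * y)
          ≈⟨ +-congʳ (*-identityˡ _) ⟨
        1# * (q ^ length H * y) + z * (q ^ length H * q ^ f * y)
          ≈⟨ solve 5 (λ o z a b y → o :* (a :* y) :+ z :* (a :* b :* y) := a :* ((o :+ z :* b) :* y))
               refl 1# z _ _ y ⟩
        q ^ length H * ((1# + z * q ^ f) * y)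
          ∎
        where
        D = randomSublist q L
        y = (1# + z * q ^ f) ^ length vs

        assoc : H ++ concatMap F (v ∷ vs) ≡ (H ++ F v) ++ concatMap F vs
        assoc = ≡.sym (List.++-assoc H (F v) (concatMap F vs))

        drop-⊆ : All (_∈ˡ L) (H ++ concatMap F vs)
        drop-⊆ = All.++⁺ (All.++⁻ˡ H ⊆L) (All.++⁻ʳ (F v) (All.++⁻ʳ H ⊆L))

        drop-u : Unique (H ++ concatMap F vs)
        drop-u = Unique-++⁻ʳ (F v) (Unique-resp-↭ (↭.shifts H (F v)) u)

    module _ {n : ℕ} (r : ℕ) (A : Subset n) {z : Carrier} (z≥0 : 0# ≤ z) where

      private
        F = edgesAt A r
        L = subsetsOfSize n (suc r)
        Π = factors L (Unique-subsetsOfSize n (suc r)) F (∣ A ∣ C r) (length-edgesAt A r) z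

      1≤factor : ∀ v G → 1# ≤ 1# + z * included (F v) G
      1≤factor v G = x≤x+y (*-nonneg z≥0 (included-nonneg (F v) G))

      -- Each common neighbour has all its edges present and contributes a factor exactly 1 + z;
      -- every other vertex outside `A` contributes at least 1. Both filters are compared along the
      -- same list of vertices.
      ^-CN-≤ : ∀ G → (1# + z) ^ length (CN (suc r) G A) ≤ Π (outsiders A) G
      ^-CN-≤ G = go (allFin n)
        where
        CN? = isCommonNeighbour? (suc r) G A
        out? = λ v → ¬? (v Subset.∈? A)

        1+z≥0 : 0# ≤ 1# + z
        1+z≥0 = ≤-trans 0≤1 (x≤x+y z≥0)

        go : ∀ vs → (1# + z) ^ length (filter CN? vs) ≤ Π (filter out? vs) G
        go [] = ≤-refl
        go (v ∷ vs) = step (v Subset.∈? A) (CN? v)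
          where
          Goal : List (Fin n) → List (Fin n) → Set _
          Goal xs ys = (1# + z) ^ length xs ≤ Π ys G

          step : Dec (v ∈ˢ A) → Dec (IsCommonNeighbour (suc r) G A v) →
                 Goal (filter CN? (v ∷ vs)) (filter out? (v ∷ vs))
          step (yes v∈A) _ = ≡.subst₂ Goal
            (≡.sym (List.filter-reject CN? (λ (v∉A , _) → v∉A v∈A)))
            (≡.sym (List.filter-reject out? (λ v∉A → v∉A v∈A)))
            (go vs)
          step (no v∉A) (yes cn@(_ , adjacent)) = ≡.subst₂ Goal
            (≡.sym (List.filter-accept CN? cn))
            (≡.sym (List.filter-accept out? v∉A))
            (*-mono-≤ 1+z≥0 (≤-reflexive (+-congˡ (sym (trans (*-congˡ (included-all edges)) (*-identityʳ z)))))
              (^-nonneg 1+z≥0 (length (filter CN? vs))) (go vs))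
            where
            edges : All (_∈ G) (F v)
            edges = All.map⁺ (All.map (λ {B} (B⊆A , ∣B∣) → adjacent B (≡.cong suc ∣B∣) B⊆A) (∈-subsetsOf⁻ A r))
          step (no v∉A) (no ¬cn) = ≡.subst₂ Goal
            (≡.sym (List.filter-reject CN? ¬cn))
            (≡.sym (List.filter-accept out? v∉A))
            (≤-trans (≤-reflexive (sym (*-identityˡ _)))
              (*-mono-≤ 0≤1 (1≤factor v G) (^-nonneg 1+z≥0 (length (filter CN? vs))) (go vs)))

      -- The size of the common neighbourhood is binomial with at most `n` trials of success
      -- probability `q ^ (∣ A ∣ C r)`; the right-hand side is the generating function of a Poisson
      -- variable with mean `n` times that probability.
      𝔼-^-CN-≤ : 𝔼 (𝔾 n q (suc r)) (λ G → (1# + z) ^ length (CN (suc r) G A)) ≤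
                 exp (fromℕ n * (z * q ^ (∣ A ∣ C r)))
      𝔼-^-CN-≤ = begin
        𝔼 (randomSublist q L) (λ G → (1# + z) ^ length (CN (suc r) G A))
          ≤⟨ 𝔼-mono (Supported-randomSublist L) (λ G _ → ^-CN-≤ G) ⟩
        𝔼 (randomSublist q L) (Π (outsiders A))
          ≈⟨ 𝔼-cong (randomSublist q L) (λ G → sym (*-identityˡ _)) ⟩
        𝔼 (randomSublist q L) (λ G → included [] G * Π (outsiders A) G)
          ≈⟨ trans (𝔼-factors L (Unique-subsetsOfSize n (suc r)) F (∣ A ∣ C r) (length-edgesAt A r) z
               (outsiders A) [] (Unique-edges A r) (edges-⊆ A r)) (*-identityˡ _) ⟩
        (1# + z * q ^ (∣ A ∣ C r)) ^ length (outsiders A)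
          ≤⟨ ^-mono-≤ (x≤x+y zQ≥0) (length-outsiders A) ⟩
        (1# + z * q ^ (∣ A ∣ C r)) ^ n
          ≤⟨ ^-monoˡ-≤ (≤-trans 0≤1 (x≤x+y zQ≥0)) (1+x≤exp _) n ⟩
        exp (z * q ^ (∣ A ∣ C r)) ^ n
          ≈⟨ exp-fromℕ-* n _ ⟨
        exp (fromℕ n * (z * q ^ (∣ A ∣ C r)))
          ∎
        where
        zQ≥0 : 0# ≤ z * q ^ (∣ A ∣ C r)
        zQ≥0 = *-nonneg z≥0 (^-nonneg q≥0 (∣ A ∣ C r))

-- The union bound

module UnionBound {c ℓ₁ ℓ₂} (R : RealNumbers c ℓ₁ ℓ₂) where
  open FiniteSets
  open RealNumbers R
  open GreedyRandomSampling R
  open RealFacts R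
  open Expectation R
  open RandomHypergraph R
  open ≤-Reasoning
  open IntegerRingSolver commutativeRing using (solve; :0; :1; _:+_; _:*_; _:-_; :-_; _:=_)

  module _ {n k r : ℕ} (r<k : r ℕ.< k) {q : Carrier} (q≥0 : 0# ≤ q) (q≤1 : q ≤ 1#) (T : ℕ) where

    private
      s = suc r
      𝒢 = 𝔾 n q s

      module Alg G = Algorithm R {n} k r r<k G

      Supported-𝒢 : Supported _ 𝒢
      Supported-𝒢 = Supported-randomSublist q≥0 q≤1 (subsetsOfSize n s)

      Normalised-𝒢 : Normalised 𝒢
      Normalised-𝒢 = Normalised-randomSublist q≥0 q≤1 (subsetsOfSize n s)

    failure≈ : 1# - successProbability n k s q T ≈ 𝔼 𝒢 (λ G → Alg.ℙfailure G T)
    failure≈ = begin-equality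
      1# - Pr (𝒢 >>= run) correct?
        ≈⟨ +-congˡ (-‿cong (Pr≈𝔼 (𝒢 >>= run) correct?)) ⟩
      1# - 𝔼 (𝒢 >>= run) correct
        ≈⟨ +-congˡ (-‿cong (trans (𝔼->>= 𝒢 run correct) (𝔼-cong 𝒢 λ G →
             trans (𝔼->>= (S G) (λ S → return (G , S)) correct) (𝔼-cong (S G) λ S → 𝔼-return (G , S) correct)))) ⟩
      1# - 𝔼 𝒢 (λ G → 𝔼 (S G) (λ S → correct (G , S)))
        ≈⟨ 𝔼-complement 𝒢 (λ G → 𝔼 (S G) (λ S → correct (G , S))) Normalised-𝒢 ⟨
      𝔼 𝒢 (λ G → 1# - 𝔼 (S G) (λ S → correct (G , S)))
        ≈⟨ 𝔼-cong 𝒢 (λ G → trans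
             (sym (𝔼-complement (S G) (λ S → correct (G , S)) (Alg.Normalised-iterate G T [])))
             (𝔼-cong (S G) λ S → sym (𝟙-¬ (isCliqueSet? s G k S)))) ⟩
      𝔼 𝒢 (λ G → Alg.ℙfailure G T)
        ∎
      where
      S : ∀ G → Dist (List (Subset n))
      S G = greedyRandomSampling k s G T

      run : Hypergraph n → Dist (Hypergraph n × List (Subset n))
      run G = S G >>= λ S → return (G , S)

      correct? : (x : Hypergraph n × List (Subset n)) → Dec (IsCliqueSet s (proj₁ x) k (proj₂ x))
      correct? (G , S) = isCliqueSet? s G k S

      correct : Hypergraph n × List (Subset n) → Carrier
      correct x = 𝟙 (correct? x)

    failure-nonneg : 0# ≤ 1# - successProbability n k s q T
    failure-nonneg = ≤-trans
      (𝔼-nonneg Supported-𝒢 λ G → 𝔼-nonneg (Alg.Supported-iterate G T (λ _ ())) λ S →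
        𝟙-nonneg (¬? (isCliqueSet? s G k S)))
      (≤-reflexive (sym failure≈))

    module _ (m θ : ℕ → Carrier) (m≥0 : ∀ i → 0# ≤ m i) (θ≥0 : ∀ i → 0# ≤ θ i) (X : Carrier) where

      -- Missing `T` times has probability at most exp(-pT), and p M ≥ 1 together with X M ≤ T gives
      -- p T ≥ X.
      ℙhit-small : ∀ {p M} → 0# ≤ X → 0# ≤ p → p ≤ 1# → 1# ≤ p * M → X * M ≤ fromℕ T →
                   (1# - p) ^ T ≤ exp (- X)
      ℙhit-small {p} {M} X≥0 p≥0 p≤1 pM≥1 XM≤T = begin
        (1# - p) ^ T             ≤⟨ ^-monoˡ-≤ (x≤y⇒0≤y-x p≤1) (1-x≤exp[-x] p) T ⟩
        exp (- p) ^ T            ≈⟨ exp-fromℕ-* T (- p) ⟨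
        exp (fromℕ T * - p)      ≈⟨ exp-cong (solve 2 (λ t p → t :* :- p := :- (p :* t)) refl (fromℕ T) p) ⟩
        exp (- (p * fromℕ T))    ≤⟨ exp-mono-≤ (neg-mono-≤ X≤pT) ⟩
        exp (- X)                ∎
        where
        X≤pT : X ≤ p * fromℕ T
        X≤pT = begin
          X              ≈⟨ *-identityʳ X ⟨
          X * 1#         ≤⟨ *-monoˡ-≤ X≥0 pM≥1 ⟩
          X * (p * M)    ≈⟨ solve 3 (λ x p m → x :* (p :* m) := p :* (x :* m)) refl X p M ⟩
          p * (X * M)    ≤⟨ *-monoˡ-≤ p≥0 XM≤T ⟩
          p * fromℕ T    ∎

      -- This is exp(θ (x - m)) for the size x of the common neighbourhood, the integrand of the
      -- Chernoff bound. The random part is a natural power, so `𝔼-^-CN-≤` applies with z = exp θ -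
      -- 1.
      penalty : (A : Subset n) → Hypergraph n → Carrier
      penalty A G = exp (θ ∣ A ∣) ^ length (CN s G A) * exp (- (θ ∣ A ∣ * m ∣ A ∣))

      penalty-nonneg : ∀ A G → 0# ≤ penalty A G
      penalty-nonneg A G = *-nonneg (^-nonneg (exp-nonneg _) (length (CN s G A))) (exp-nonneg _)

      penalty-≥1 : ∀ A G → m ∣ A ∣ ≤ fromℕ (length (CN s G A)) → 1# ≤ penalty A G
      penalty-≥1 A G m≤CN = ≤-trans
        (exp-≥1 (≤-trans (*-nonneg (θ≥0 ∣ A ∣) (x≤y⇒0≤y-x m≤CN)) (≤-reflexive
          (solve 3 (λ t x m → t :* (x :- m) := x :* t :- t :* m) refl (θ ∣ A ∣) (fromℕ (length (CN s G A))) (m ∣ A ∣)))))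
        (≤-reflexive (trans (exp-+ _ _) (*-congʳ (exp-fromℕ-* (length (CN s G A)) (θ ∣ A ∣)))))

      penalties : Hypergraph n → Carrier
      penalties G = ∑ (upTo k) (λ i → ∑ (subsetsOf ⊤ i) (λ A → penalty A G))

      penalty-≤-penalties : ∀ A G → ∣ A ∣ ℕ.< k → penalty A G ≤ penalties G
      penalty-≤-penalties A G A<k = ≤-trans
        (∑-≥-term (λ A → penalty-nonneg A G) (∈-subsetsOf-⊤ A))
        (∑-≥-term (λ i → ∑-nonneg (subsetsOf ⊤ i) (λ A → penalty-nonneg A G)) (∈.∈-upTo⁺ A<k))

      module _ (X≥0 : 0# ≤ X)
               (XM≤T : X * (fromℕ n ^ r * ∏ m r (k ∸ r)) ≤ fromℕ T) where

        -- Either some common neighbourhood exceeds its threshold, and its penalty alone is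
        -- at least 1, or every clique is likely to be hit.
        ℙfailure-≤-penalties : ∀ G → Alg.ℙfailure G T ≤ fromℕ n ^ k * exp (- X) + penalties G
        ℙfailure-≤-penalties G lt = ≤-trans few-misses (x≤x+y penalties≥0) lt
          where
          penalties≥0 : 0# ≤ penalties G
          penalties≥0 = ∑-nonneg (upTo k) λ i → ∑-nonneg (subsetsOf ⊤ i) λ A → penalty-nonneg A G

          -- Here `lt` assumes that the claimed bound fails. One exceeded threshold would already
          -- make it true, so under `lt` none is exceeded, and the hypothesis of `ℙhit-≥` is
          -- obtained without deciding a comparison of reals.
          CN≤m : ∀ A → ∣ A ∣ ℕ.< k → fromℕ (length (CN s G A)) ≤ m ∣ A ∣
          CN≤m A A<k m<CN = ≤-trans (Alg.ℙfailure-≤1 G T)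
            (≤-trans (penalty-≥1 A G (<⇒≤ m<CN)) (≤-trans (penalty-≤-penalties A G A<k)
              (x≤y+x (*-nonneg (^-nonneg (fromℕ-nonneg n) k) (exp-nonneg _)))))
            lt

          missed : ∀ W → 𝟙 (isClique? s G k W) * (1# - Alg.ℙhit G W) ^ T ≤ exp (- X)
          missed W = by-cases (isClique? s G k W)
            where
            by-cases : (d : Dec (IsClique s G k W)) → 𝟙 d * (1# - Alg.ℙhit G W) ^ T ≤ exp (- X)
            by-cases (no _)       = ≤-trans (≤-reflexive (zeroˡ _)) (exp-nonneg _)
            by-cases (yes clique) = ≤-trans (≤-reflexive (*-identityˡ _))
              (ℙhit-small X≥0 (𝔼-nonneg (Alg.Supported-sample G) (Alg.hit-nonneg G W)) (Alg.ℙhit-≤1 G W)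
                (Alg.ℙhit-≥ G m m≥0 CN≤m clique) XM≤T)

          few-misses : Alg.ℙfailure G T ≤ fromℕ n ^ k * exp (- X)
          few-misses = begin
            Alg.ℙfailure G T
              ≤⟨ Alg.ℙfailure-≤ G T ⟩
            ∑ Ws (λ W → 𝟙 (isClique? s G k W) * (1# - Alg.ℙhit G W) ^ T)
              ≤⟨ ∑-mono (All.universal missed Ws) ⟩
            ∑ Ws (const (exp (- X)))
              ≈⟨ ∑-const Ws _ ⟩
            fromℕ (length Ws) * exp (- X)
              ≤⟨ *-monoʳ-≤ (exp-nonneg _) (≤-trans (fromℕ-mono-≤ (length-subsetsOf-⊤ n k)) (≤-reflexive (fromℕ-^ n k))) ⟩
            fromℕ n ^ k * exp (- X)
              ∎
            where Ws = subsetsOf {n} ⊤ k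

        module _ (n≥1 : 1 ℕ.≤ n) (tail : ∀ i → i ℕ.< k →
          exp (fromℕ n * ((exp (θ i) - 1#) * q ^ (i C r)) - θ i * m i) ≤ exp (- X)) where

          𝔼-penalty-≤ : ∀ A → ∣ A ∣ ℕ.< k → 𝔼 𝒢 (penalty A) ≤ exp (- X)
          𝔼-penalty-≤ A A<k = begin
            𝔼 𝒢 (penalty A)
              ≈⟨ trans (𝔼-cong 𝒢 (λ G → *-comm _ _)) (𝔼-*ˡ 𝒢 _ _) ⟩
            exp (- (θ′ * m ∣ A ∣)) * 𝔼 𝒢 (λ G → exp θ′ ^ length (CN s G A))
              ≈⟨ *-congˡ (𝔼-cong 𝒢 (λ G → ^-congˡ (length (CN s G A))
                   (solve 2 (λ o e → e := o :+ (e :- o)) refl 1# (exp θ′)))) ⟩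
            exp (- (θ′ * m ∣ A ∣)) * 𝔼 𝒢 (λ G → (1# + (exp θ′ - 1#)) ^ length (CN s G A))
              ≤⟨ *-monoˡ-≤ (exp-nonneg _) (𝔼-^-CN-≤ q≥0 q≤1 r A (x≤y⇒0≤y-x (exp-≥1 (θ≥0 ∣ A ∣)))) ⟩
            exp (- (θ′ * m ∣ A ∣)) * exp (fromℕ n * ((exp θ′ - 1#) * q ^ (∣ A ∣ C r)))
              ≈⟨ trans (*-comm _ _) (sym (exp-+ _ _)) ⟩
            exp (fromℕ n * ((exp θ′ - 1#) * q ^ (∣ A ∣ C r)) - θ′ * m ∣ A ∣)
              ≤⟨ tail ∣ A ∣ A<k ⟩
            exp (- X)
              ∎
            where θ′ = θ ∣ A ∣

          𝔼-penalties-≤ : 𝔼 𝒢 penalties ≤ fromℕ k * (fromℕ n ^ k * exp (- X))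
          𝔼-penalties-≤ = begin
            𝔼 𝒢 penalties
              ≈⟨ 𝔼-∑ 𝒢 (upTo k) _ ⟩
            ∑ (upTo k) (λ i → 𝔼 𝒢 (λ G → ∑ (subsetsOf ⊤ i) (λ A → penalty A G)))
              ≤⟨ ∑-mono (All.tabulate (λ i∈ → layer (∈.∈-upTo⁻ i∈))) ⟩
            ∑ (upTo k) (const (fromℕ n ^ k * exp (- X)))
              ≈⟨ trans (∑-const (upTo k) _) (*-congʳ (reflexive (≡.cong fromℕ (List.length-upTo k)))) ⟩
            fromℕ k * (fromℕ n ^ k * exp (- X))
              ∎
            where
            layer : ∀ {i} → i ℕ.< k →
                    𝔼 𝒢 (λ G → ∑ (subsetsOf ⊤ i) (λ A → penalty A G)) ≤ fromℕ n ^ k * exp (- X)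
            layer {i} i<k = begin
              𝔼 𝒢 (λ G → ∑ As (λ A → penalty A G))
                ≈⟨ 𝔼-∑ 𝒢 As penalty ⟩
              ∑ As (λ A → 𝔼 𝒢 (penalty A))
                ≤⟨ ∑-mono (All.map (λ {A} (_ , ∣A∣) → 𝔼-penalty-≤ A (≡.subst (ℕ._< k) (≡.sym ∣A∣) i<k)) (∈-subsetsOf⁻ {n} ⊤ i)) ⟩
              ∑ As (const (exp (- X)))
                ≈⟨ ∑-const As _ ⟩
              fromℕ (length As) * exp (- X)
                ≤⟨ *-monoʳ-≤ (exp-nonneg _) (begin
                     fromℕ (length As)   ≤⟨ fromℕ-mono-≤ (length-subsetsOf-⊤ n i) ⟩
                     fromℕ (n ℕ.^ i)     ≈⟨ fromℕ-^ n i ⟩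
                     fromℕ n ^ i         ≤⟨ ^-mono-≤ n≥1′ (ℕ.<⇒≤ i<k) ⟩
                     fromℕ n ^ k         ∎) ⟩
              fromℕ n ^ k * exp (- X)
                ∎
              where
              As = subsetsOf {n} ⊤ i

              n≥1′ : 1# ≤ fromℕ n
              n≥1′ = ≤-trans (≤-reflexive (sym (+-identityʳ 1#))) (fromℕ-mono-≤ n≥1)

          -- Of the `suc k` equal terms, one pays for the missed cliques and one for each layer of
          -- sets of a given size below `k`.
          failure-bound : 1# - successProbability n k s q T ≤ fromℕ (suc k) * (fromℕ n ^ k * exp (- X))
          failure-bound = begin
            1# - successProbability n k s q T
              ≈⟨ failure≈ ⟩
            𝔼 𝒢 (λ G → Alg.ℙfailure G T)
              ≤⟨ 𝔼-mono Supported-𝒢 (λ G _ → ℙfailure-≤-penalties G) ⟩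
            𝔼 𝒢 (λ G → fromℕ n ^ k * exp (- X) + penalties G)
              ≈⟨ trans (𝔼-+ 𝒢 _ penalties) (+-congʳ (𝔼-const 𝒢 Normalised-𝒢 _)) ⟩
            fromℕ n ^ k * exp (- X) + 𝔼 𝒢 penalties
              ≤⟨ +-monoʳ-≤ _ 𝔼-penalties-≤ ⟩
            fromℕ n ^ k * exp (- X) + fromℕ k * (fromℕ n ^ k * exp (- X))
              ≈⟨ solve 2 (λ k y → y :+ k :* y := (:1 :+ k) :* y) refl (fromℕ k) _ ⟩
            fromℕ (suc k) * (fromℕ n ^ k * exp (- X))
              ∎

-- Asymptotics

module Estimates {c ℓ₁ ℓ₂} (R : RealNumbers c ℓ₁ ℓ₂) where
  open RealNumbers R
  open GreedyRandomSampling R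
  open RealFacts R
  open ≤-Reasoning
  open IntegerRingSolver commutativeRing using (solve; :0; :1; _:+_; _:*_; _:-_; :-_; _:=_)

  -- Comes from exp(-½) ≥ 1 - ½ = ½ by taking inverses.
  exp½≤2 : exp ½ ≤ fromℕ 2
  exp½≤2 = begin
    exp ½                              ≈⟨ *-identityʳ _ ⟨
    exp ½ * 1#                         ≈⟨ *-congˡ ½+½≈1 ⟨
    exp ½ * (½ + ½)                    ≈⟨ *-congˡ (+-cong ½≈1-½ ½≈1-½) ⟩
    exp ½ * ((1# - ½) + (1# - ½))      ≤⟨ *-monoˡ-≤ (exp-nonneg ½) (+-mono-≤ (1-x≤exp[-x] ½) (1-x≤exp[-x] ½)) ⟩
    exp ½ * (exp (- ½) + exp (- ½))    ≈⟨ distribˡ _ _ _ ⟩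
    exp ½ * exp (- ½) + exp ½ * exp (- ½)  ≈⟨ +-cong (exp-inverseʳ ½) (trans (exp-inverseʳ ½) (sym (+-identityʳ 1#))) ⟩
    fromℕ 2                            ∎
    where
    ½≈1-½ : ½ ≈ 1# - ½
    ½≈1-½ = trans (solve 1 (λ h → h := h :+ h :- h) refl ½) (+-congʳ ½+½≈1)

  -- The tangent bound at -θ gives exp θ - 1 ≤ θ exp θ, and exp θ + θ ≤ (exp θ)(1 + θ) ≤ exp(2θ).
  -- The second factor exp θ on the right is what pays for the term θ².
  exp-1+θ²≤ : ∀ {θ} → 0# ≤ θ → exp θ - 1# + θ * θ ≤ θ * exp (θ + θ)
  exp-1+θ²≤ {θ} θ≥0 = begin
    e - 1# + θ * θ                ≈⟨ +-congʳ (+-congˡ (-‿cong (exp-inverseʳ θ))) ⟨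
    e - e * exp (- θ) + θ * θ     ≤⟨ +-monoˡ-≤ _ (+-monoʳ-≤ e (neg-mono-≤ (*-monoˡ-≤ (exp-nonneg θ) (1-x≤exp[-x] θ)))) ⟩
    e - e * (1# - θ) + θ * θ      ≈⟨ +-congʳ (+-congʳ (*-identityʳ e)) ⟨
    e * 1# - e * (1# - θ) + θ * θ ≈⟨ solve 3 (λ e o t → e :* o :- e :* (o :- t) :+ t :* t := t :* (e :+ t)) refl e 1# θ ⟩
    θ * (e + θ)                   ≤⟨ *-monoˡ-≤ θ≥0 e+θ≤e*e ⟩
    θ * (e * e)                   ≈⟨ *-congˡ (exp-+ θ θ) ⟨
    θ * exp (θ + θ)               ∎
    where
    e = exp θ

    e+θ≤e*e : e + θ ≤ e * e
    e+θ≤e*e = begin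
      e + θ            ≈⟨ +-congˡ (*-identityˡ θ) ⟨
      e + 1# * θ       ≤⟨ +-monoʳ-≤ e (*-monoʳ-≤ θ≥0 (exp-≥1 θ≥0)) ⟩
      e + e * θ        ≈⟨ trans (distribˡ e 1# θ) (+-congʳ (*-identityʳ e)) ⟨
      e * (1# + θ)     ≤⟨ *-monoˡ-≤ (exp-nonneg θ) (1+x≤exp θ) ⟩
      e * e            ∎

  -- Here `y` is the mean and exp(2θ) plays the role of 1 + δ. The optimal tilt for the threshold
  -- exp(2θ) y is 2θ; using half of it still gives an exponent linear in `y`, without any logarithm
  -- of 1 + δ.
  Chernoff-exponent : ∀ {θ y} → 0# ≤ θ → 0# ≤ y →
                      y * (exp θ - 1#) - θ * (exp (θ + θ) * y) ≤ - (θ * θ * y)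
  Chernoff-exponent {θ} {y} θ≥0 y≥0 = 0≤y-x⇒x≤y (≤-trans
    (x≤y⇒0≤y-x (*-monoˡ-≤ y≥0 (exp-1+θ²≤ θ≥0)))
    (≤-reflexive (solve 4 (λ y t e f → y :* (t :* f) :- y :* (e :+ t :* t)
                                       := :- (t :* t :* y) :- (y :* e :- t :* (f :* y)))
      refl y θ (exp θ - 1#) (exp (θ + θ)))))

  -- The square of x/2 ≤ exp(x/2). Quadratic growth is enough for a positive power of n to outgrow
  -- every multiple of log n.
  square-≤-exp : ∀ {x} → 0# ≤ x → (½ * x) * (½ * x) ≤ exp x
  square-≤-exp {x} x≥0 = ≤-trans (*-mono-≤ ½x≥0 (x≤exp _) ½x≥0 (x≤exp _))
    (≤-reflexive (trans (sym (exp-+ _ _)) (exp-cong (sym (halves x)))))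
    where
    ½x≥0 = *-nonneg (<⇒≤ ½-pos) x≥0

  -- Of the exponent (j + 1)(1 + ε), the part j + 1 covers the powers of `x` on the left, one ε
  -- absorbs `K` by K ≤ ε log x ≤ x^ε, and the remaining j ε is given away.
  pow-superlinear : ∀ {x ε K} (x>0 : 0# < x) → 0# ≤ log x x>0 → 0# ≤ ε → K ≤ ε * log x x>0 → ∀ j →
                    K * x * x ^ j ≤ pow x x>0 (fromℕ (suc j) * (1# + ε))
  pow-superlinear {x} {ε} {K} x>0 l≥0 ε≥0 K≤εl j = begin
    K * x * x ^ j
      ≤⟨ *-monoʳ-≤ (^-nonneg (<⇒≤ x>0) j) (*-monoʳ-≤ (<⇒≤ x>0) (≤-trans K≤εl (x≤exp _))) ⟩
    exp (ε * l) * x * x ^ j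
      ≈⟨ *-cong (*-congˡ (sym exp-l)) (trans (^-congˡ j (sym exp-l)) (sym (exp-fromℕ-* j l))) ⟩
    exp (ε * l) * exp l * exp (fromℕ j * l)
      ≈⟨ trans (*-congʳ (sym (exp-+ _ _))) (sym (exp-+ _ _)) ⟩
    exp (ε * l + l + fromℕ j * l)
      ≤⟨ exp-mono-≤ (x≤x+y (*-nonneg (*-nonneg (fromℕ-nonneg j) ε≥0) l≥0)) ⟩
    exp (ε * l + l + fromℕ j * l + fromℕ j * ε * l)
      ≈⟨ exp-cong (solve 3 (λ e l j → e :* l :+ l :+ j :* l :+ j :* e :* l
                                      := (:1 :+ j) :* (:1 :+ e) :* l) refl ε l (fromℕ j)) ⟩
    exp (fromℕ (suc j) * (1# + ε) * l)
      ∎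
    where
    l = log x x>0
    exp-l = exp-log x x>0

  Eventually-∩ : ∀ {a b} {P : ∀ n → .{{NonTrivial n}} → Set a} {Q : ∀ n → .{{NonTrivial n}} → Set b} →
                 Eventually P → Eventually Q → Eventually (λ n → P n × Q n)
  Eventually-∩ (M , f) (N , g) = M ℕ.⊔ N , λ n le →
    f n (ℕ.≤-trans (ℕ.m≤m⊔n M N) le) , g n (ℕ.≤-trans (ℕ.m≤n⊔m M N) le)

  Eventually-map : ∀ {a b} {P : ∀ n → .{{NonTrivial n}} → Set a} {Q : ∀ n → .{{NonTrivial n}} → Set b} →
                   (∀ n → .{{_ : NonTrivial n}} → P n → Q n) → Eventually P → Eventually Q
  Eventually-map P⇒Q (N , f) = N , λ n le → P⇒Q n (f n le)

  logℕ-large : ∀ X → Eventually (λ n → X ≤ logℕ n)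
  logℕ-large X with archimedean (exp X)
  ... | N , expX<N = N , λ n N≤n →
    log-≥ (fromℕ n) (fromℕ-pos′ n) X (<-≤-trans expX<N (fromℕ-mono-≤ N≤n))

  -- For an edge probability u n^(-α), the mean n q^D equals u^D n^(1 - αD). The sign of 1 - αD is
  -- what separates sizes up to τ from sizes above τ.
  power-scaling : ∀ n .{{_ : NonTrivial n}} u α D →
    fromℕ n * (u * pow (fromℕ n) (fromℕ-pos′ n) (- α)) ^ D ≈ u ^ D * exp ((1# - α * fromℕ D) * logℕ n)
  power-scaling n u α D = begin-equality
    fromℕ n * (u * exp (- α * L)) ^ D
      ≈⟨ *-cong (sym (exp-log _ _)) (trans (^-distrib-* u _ D) (*-congˡ (sym (exp-fromℕ-* D _)))) ⟩
    exp L * (u ^ D * exp (fromℕ D * (- α * L)))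
      ≈⟨ solve 3 (λ x y z → x :* (y :* z) := y :* (x :* z)) refl _ _ _ ⟩
    u ^ D * (exp L * exp (fromℕ D * (- α * L)))
      ≈⟨ *-congˡ (trans (sym (exp-+ _ _)) (exp-cong
           (solve 3 (λ l d a → l :+ d :* (:- a :* l) := (:1 :- a :* d) :* l) refl L (fromℕ D) α))) ⟩
    u ^ D * exp ((1# - α * fromℕ D) * L)
      ∎
    where L = logℕ n

  ∏-++ : ∀ m i j j′ → ∏ m i (j ℕ.+ j′) ≈ ∏ m i j * ∏ m (i ℕ.+ j) j′
  ∏-++ m i zero    j′ = trans (reflexive (≡.cong (λ l → ∏ m l j′) (≡.sym (ℕ.+-identityʳ i)))) (sym (*-identityˡ _))
  ∏-++ m i (suc j) j′ = trans (*-congˡ (trans (∏-++ m (suc i) j j′)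
    (*-congˡ (reflexive (≡.cong (λ l → ∏ m l j′) (≡.sym (ℕ.+-suc i j))))))) (sym (*-assoc _ _ _))

  -- The bound for one fixed number of vertices

  module AtSize {n k r τ : ℕ} .{{_ : NonTrivial n}} (r<k : r ℕ.< k) (r≤τ : r ℕ.≤ τ)
    {q : Carrier} (q≥0 : 0# ≤ q) (q≤1 : q ≤ 1#)
    {θ₀ : Carrier} (θ₀≥0 : 0# ≤ θ₀) (kθ₀ : fromℕ k * (θ₀ + θ₀) ≈ ½)
    {K : Carrier} (K≥1 : 1# ≤ K) (L≥1 : 1# ≤ logℕ n)
    (dense  : ∀ i → i ℕ.≤ τ → K * logℕ n ≤ θ₀ * θ₀ * (fromℕ n * q ^ (i C r)))
    (sparse : ∀ i → τ ℕ.< i → exp K * (fromℕ n * q ^ (i C r)) ≤ logℕ n)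
    where

    private
      s = suc r
      L = logℕ n
      N = fromℕ n
      E = exp (θ₀ + θ₀)

      L≥0 : 0# ≤ L
      L≥0 = ≤-trans 0≤1 L≥1

      K≥0 : 0# ≤ K
      K≥0 = ≤-trans 0≤1 K≥1

      X≥0 : 0# ≤ K * L
      X≥0 = *-nonneg K≥0 L≥0

      3L≥0 : 0# ≤ fromℕ 3 * L
      3L≥0 = *-nonneg (fromℕ-nonneg 3) L≥0

      NQ≥0 : ∀ i → 0# ≤ N * q ^ (i C r)
      NQ≥0 i = *-nonneg (fromℕ-nonneg n) (^-nonneg q≥0 (i C r))

    -- Up to size τ common neighbourhoods concentrate around n q^C(i, s−1), which a small
    -- tilt θ₀ detects; above τ their expected size is bounded, and a constant but large
    -- tilt K makes exceeding 3 log n superpolynomially unlikely.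
    bound : ∀ i → Dec (i ℕ.≤ τ) → Carrier
    bound i (yes _) = E * (N * q ^ (i C r))
    bound i (no _)  = fromℕ 3 * L

    tilt : ∀ i → Dec (i ℕ.≤ τ) → Carrier
    tilt i (yes _) = θ₀
    tilt i (no _)  = K

    m θ : ℕ → Carrier
    m i = bound i (i ℕ.≤? τ)
    θ i = tilt i (i ℕ.≤? τ)

    bound-nonneg : ∀ i d → 0# ≤ bound i d
    bound-nonneg i (yes _) = *-nonneg (exp-nonneg _) (NQ≥0 i)
    bound-nonneg i (no _)  = 3L≥0

    tilt-nonneg : ∀ i d → 0# ≤ tilt i d
    tilt-nonneg i (yes _) = θ₀≥0
    tilt-nonneg i (no _)  = K≥0

    bound-low : ∀ i d → i ℕ.≤ τ → bound i d ≡ E * (N * q ^ (i C r))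
    bound-low i (yes _)   i≤τ = ≡.refl
    bound-low i (no i≰τ) i≤τ = contradiction i≤τ i≰τ

    bound-high : ∀ i d → τ ℕ.< i → bound i d ≡ fromℕ 3 * L
    bound-high i (yes i≤τ) τ<i = contradiction i≤τ (ℕ.<⇒≱ τ<i)
    bound-high i (no _)    τ<i = ≡.refl

    tail : ∀ i d → exp (N * ((exp (tilt i d) - 1#) * q ^ (i C r)) - tilt i d * bound i d) ≤ exp (- (K * L))
    tail i (yes i≤τ) = exp-mono-≤ (begin
      N * ((exp θ₀ - 1#) * q ^ (i C r)) - θ₀ * (E * (N * q ^ (i C r)))
        ≈⟨ +-congʳ (solve 3 (λ n e q → n :* (e :* q) := n :* q :* e) refl N _ _) ⟩
      N * q ^ (i C r) * (exp θ₀ - 1#) - θ₀ * (E * (N * q ^ (i C r)))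
        ≤⟨ Chernoff-exponent θ₀≥0 (NQ≥0 i) ⟩
      - (θ₀ * θ₀ * (N * q ^ (i C r)))
        ≤⟨ neg-mono-≤ (dense i i≤τ) ⟩
      - (K * L)
        ∎)
    tail i (no i≰τ) = exp-mono-≤ (begin
      N * ((exp K - 1#) * q ^ (i C r)) - K * (fromℕ 3 * L)
        ≤⟨ +-monoˡ-≤ _ NzQ≤KL ⟩
      K * L - K * (fromℕ 3 * L)
        -- The tilted threshold outweighs the moment by 2 K L; half of this surplus is given up to
        -- reach the bound shared with the sizes up to τ.
        ≤⟨ x≤x+y X≥0 ⟩
      K * L - K * (fromℕ 3 * L) + K * L
        ≈⟨ solve 2 (λ k l → k :* l :- k :* ((:1 :+ (:1 :+ (:1 :+ :0))) :* l) :+ k :* l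
                            := :- (k :* l)) refl K L ⟩
      - (K * L)
        ∎)
      where
      Q = q ^ (i C r)

      NzQ≤KL : N * ((exp K - 1#) * Q) ≤ K * L
      NzQ≤KL = begin
        N * ((exp K - 1#) * Q)   ≈⟨ solve 3 (λ n e q → n :* (e :* q) := e :* (n :* q)) refl N _ _ ⟩
        (exp K - 1#) * (N * Q)   ≤⟨ *-monoʳ-≤ (NQ≥0 i) (≤-trans (x≤x+y 0≤1) (≤-reflexive
                                      (solve 2 (λ e o → e :- o :+ o := e) refl (exp K) 1#))) ⟩
        exp K * (N * Q)          ≤⟨ sparse i (ℕ.≰⇒> i≰τ) ⟩
        L                        ≈⟨ *-identityˡ L ⟨
        1# * L                   ≤⟨ *-monoʳ-≤ L≥0 K≥1 ⟩
        K * L                    ∎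

    -- Adding a vertex to an i-clique adds C(i, s-1) edges, and C(i, s-1) + C(i, s) = C(i+1, s).
    -- Hence each threshold turns n^i q^C(i, s), roughly the expected number of ordered i-cliques,
    -- into the same quantity for i + 1, up to one factor `E`.
    ∏-low : ∀ i j → i ℕ.+ j ℕ.≤ suc τ →
            N ^ i * q ^ (i C s) * ∏ m i j ≈ E ^ j * (N ^ (i ℕ.+ j) * q ^ ((i ℕ.+ j) C s))
    ∏-low i zero    le = trans (*-identityʳ _) (trans
      (reflexive (≡.cong (λ l → N ^ l * q ^ (l C s)) (≡.sym (ℕ.+-identityʳ i)))) (sym (*-identityˡ _)))
    ∏-low i (suc j) le = begin-equality
      N ^ i * q ^ (i C s) * (m i * ∏ m (suc i) j)
        ≈⟨ *-congˡ (*-congʳ (reflexive (bound-low i (i ℕ.≤? τ) i≤τ))) ⟩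
      N ^ i * q ^ (i C s) * (E * (N * q ^ (i C r)) * ∏ m (suc i) j)
        ≈⟨ solve 6 (λ ni qs e n qr p → ni :* qs :* (e :* (n :* qr) :* p) := e :* (n :* ni :* (qr :* qs) :* p))
             refl (N ^ i) (q ^ (i C s)) E N (q ^ (i C r)) (∏ m (suc i) j) ⟩
      E * (N ^ suc i * (q ^ (i C r) * q ^ (i C s)) * ∏ m (suc i) j)
        ≈⟨ *-congˡ (*-congʳ (*-congˡ (trans (sym (^-homo-* q (i C r) (i C s))) (^-≡ q (nCk+nC[k+1]≡[n+1]C[k+1] i r))))) ⟩
      E * (N ^ suc i * q ^ (suc i C s) * ∏ m (suc i) j)
        ≈⟨ *-congˡ (∏-low (suc i) j le′) ⟩
      E * (E ^ j * (N ^ (suc i ℕ.+ j) * q ^ ((suc i ℕ.+ j) C s)))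
        ≈⟨ trans (sym (*-assoc _ _ _)) (reflexive (≡.cong (λ l → E ^ suc j * (N ^ l * q ^ (l C s))) (≡.sym (ℕ.+-suc i j)))) ⟩
      E ^ suc j * (N ^ (i ℕ.+ suc j) * q ^ ((i ℕ.+ suc j) C s))
        ∎
      where
      le′ : suc i ℕ.+ j ℕ.≤ suc τ
      le′ = ≡.subst (ℕ._≤ suc τ) (ℕ.+-suc i j) le

      i≤τ : i ℕ.≤ τ
      i≤τ = ℕ.≤-pred (ℕ.≤-trans (ℕ.m≤m+n (suc i) j) le′)

    ∏-high : ∀ i j → τ ℕ.< i → ∏ m i j ≈ (fromℕ 3 * L) ^ j
    ∏-high i zero    τ<i = refl
    ∏-high i (suc j) τ<i = *-cong (reflexive (bound-high i (i ℕ.≤? τ) τ<i)) (∏-high (suc i) j (ℕ.m<n⇒m<1+n τ<i))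

    starts-≤ : ∀ t → r ℕ.≤ t → t ℕ.≤ suc τ → t ℕ.≤ k →
               N ^ r * ∏ m r (t ∸ r) ≤ fromℕ 2 * N ^ t * q ^ (t C s)
    starts-≤ t r≤t t≤1+τ t≤k = begin
      N ^ r * ∏ m r (t ∸ r)
        -- C(s-1, s) = 0: the starting vertices span no edge, so the telescoping begins at n^(s-1)
        -- with no power of `q`.
        ≈⟨ *-congʳ (trans (*-congˡ (^-≡ q (k>n⇒nCk≡0 (ℕ.n<1+n r)))) (*-identityʳ _)) ⟨
      N ^ r * q ^ (r C s) * ∏ m r (t ∸ r)
        ≈⟨ ∏-low r (t ∸ r) (≡.subst (ℕ._≤ suc τ) (≡.sym r+[t∸r]≡t) t≤1+τ) ⟩
      E ^ (t ∸ r) * (N ^ (r ℕ.+ (t ∸ r)) * q ^ ((r ℕ.+ (t ∸ r)) C s))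
        ≈⟨ *-congˡ (reflexive (≡.cong (λ l → N ^ l * q ^ (l C s)) r+[t∸r]≡t)) ⟩
      E ^ (t ∸ r) * (N ^ t * q ^ (t C s))
        ≤⟨ *-monoʳ-≤ (*-nonneg (^-nonneg (fromℕ-nonneg n) t) (^-nonneg q≥0 (t C s))) E^≤2 ⟩
      fromℕ 2 * (N ^ t * q ^ (t C s))
        ≈⟨ *-assoc _ _ _ ⟨
      fromℕ 2 * N ^ t * q ^ (t C s)
        ∎
      where
      r+[t∸r]≡t = ℕ.m+[n∸m]≡n r≤t

      E^≤2 : E ^ (t ∸ r) ≤ fromℕ 2
      E^≤2 = begin
        E ^ (t ∸ r)                ≤⟨ ^-mono-≤ (exp-≥1 (+-nonneg θ₀≥0 θ₀≥0)) (ℕ.≤-trans (ℕ.m∸n≤m t r) t≤k) ⟩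
        E ^ k                      ≈⟨ exp-fromℕ-* k _ ⟨
        exp (fromℕ k * (θ₀ + θ₀))  ≈⟨ exp-cong kθ₀ ⟩
        exp ½                      ≤⟨ exp½≤2 ⟩
        fromℕ 2                    ∎

    module _ {ε : Carrier} (ε≥0 : 0# ≤ ε)
             (large : ∀ x (x>0 : 0# < x) → L ≤ x → (0# ≤ log x x>0) × (K ≤ ε * log x x>0))
             {T : ℕ} (enough : EnoughIterations n k s τ q ε T) where

      private
        B : ℕ → Carrier
        B t = fromℕ 2 * N ^ t * q ^ (t C s)

        B≥0 : ∀ t → 0# ≤ B t
        B≥0 t = *-nonneg (*-nonneg (fromℕ-nonneg 2) (^-nonneg (fromℕ-nonneg n) t)) (^-nonneg q≥0 (t C s))

        L≤3L : L ≤ fromℕ 3 * L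
        L≤3L = x≤n*x 2 L≥0

      -- If k > τ, the product is split at size τ + 1. Only k - τ - 1 thresholds lie above τ, so one
      -- of the k - τ powers in the hypothesis remains to absorb K log n. If k ≤ τ, no threshold
      -- lies above τ and the single power (log n)^(1+ε) absorbs it.
      iterations : Dec (suc τ ℕ.≤ k) → K * L * (N ^ r * ∏ m r (k ∸ r)) ≤ fromℕ T
      iterations (yes τ<k) = begin
        K * L * (N ^ r * ∏ m r (k ∸ r))
          ≈⟨ *-congˡ (trans (*-congˡ (trans (reflexive (≡.cong (∏ m r) k∸r≡)) (∏-++ m r (suc τ ∸ r) j)))
               (sym (*-assoc _ _ _))) ⟩
        K * L * (N ^ r * ∏ m r (suc τ ∸ r) * ∏ m (r ℕ.+ (suc τ ∸ r)) j)
          ≈⟨ *-congˡ (*-congˡ (trans (reflexive (≡.cong (λ l → ∏ m l j) (ℕ.m+[n∸m]≡n r≤1+τ)))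
               (∏-high (suc τ) j ℕ.≤-refl))) ⟩
        K * L * (N ^ r * ∏ m r (suc τ ∸ r) * 3L ^ j)
          ≤⟨ *-monoˡ-≤ X≥0 (*-monoʳ-≤ (^-nonneg 3L≥0 j) (starts-≤ (suc τ) r≤1+τ ℕ.≤-refl τ<k)) ⟩
        K * L * (B (suc τ) * 3L ^ j)
          -- `L` is enlarged to `3L` so that it joins the `j` high thresholds as one more power of
          -- the same base.
          ≤⟨ *-monoʳ-≤ (*-nonneg (B≥0 (suc τ)) (^-nonneg 3L≥0 j)) (*-monoˡ-≤ K≥0 L≤3L) ⟩
        K * 3L * (B (suc τ) * 3L ^ j)
          ≈⟨ solve 3 (λ x b y → x :* (b :* y) := b :* (x :* y)) refl (K * 3L) (B (suc τ)) (3L ^ j) ⟩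
        B (suc τ) * (K * 3L * 3L ^ j)
          ≤⟨ *-monoˡ-≤ (B≥0 (suc τ)) (pow-superlinear 3L>0 (proj₁ (large 3L 3L>0 L≤3L)) ε≥0 (proj₂ (large 3L 3L>0 L≤3L)) j) ⟩
        B (suc τ) * pow 3L 3L>0 (fromℕ (suc j) * (1# + ε))
          ≈⟨ *-congˡ (reflexive (≡.cong (λ l → pow 3L 3L>0 (fromℕ l * (1# + ε))) k∸τ≡)) ⟨
        B (suc τ) * pow 3L 3L>0 (fromℕ (k ∸ τ) * (1# + ε))
          ≤⟨ proj₁ enough τ<k ⟩
        fromℕ T
          ∎
        where
        j = k ∸ suc τ
        3L = fromℕ 3 * L

        3L>0 : 0# < 3L
        3L>0 = *-pos (fromℕ-pos 3) (logℕ-pos n)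

        r≤1+τ : r ℕ.≤ suc τ
        r≤1+τ = ℕ.m≤n⇒m≤1+n r≤τ

        1+τ+j≡k : suc τ ℕ.+ j ≡ k
        1+τ+j≡k = ℕ.m+[n∸m]≡n τ<k

        k∸r≡ : k ∸ r ≡ suc τ ∸ r ℕ.+ j
        k∸r≡ = ≡.trans (≡.cong (_∸ r) (≡.sym 1+τ+j≡k)) (ℕ.+-∸-comm j r≤1+τ)

        k∸τ≡ : k ∸ τ ≡ suc j
        k∸τ≡ = ≡.trans (≡.cong (_∸ τ) (≡.trans (≡.sym 1+τ+j≡k) (≡.sym (ℕ.+-suc τ j)))) (ℕ.m+n∸m≡n τ (suc j))
      iterations (no τ≮k) = begin
        K * L * (N ^ r * ∏ m r (k ∸ r))
          ≤⟨ *-monoˡ-≤ X≥0 (starts-≤ k (ℕ.<⇒≤ r<k) (ℕ.m≤n⇒m≤1+n (ℕ.≮⇒≥ τ≮k)) ℕ.≤-refl) ⟩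
        K * L * B k
          ≈⟨ trans (*-comm _ _) (*-congˡ (sym (*-identityʳ _))) ⟩
        B k * (K * L * L ^ 0)
          ≤⟨ *-monoˡ-≤ (B≥0 k) (pow-superlinear L>0 (proj₁ (large L L>0 ≤-refl)) ε≥0 (proj₂ (large L L>0 ≤-refl)) 0) ⟩
        B k * pow L L>0 (fromℕ 1 * (1# + ε))
          ≈⟨ *-congˡ (exp-cong (*-congʳ (trans (*-congʳ (+-identityʳ 1#)) (*-identityˡ _)))) ⟩
        B k * pow L L>0 (1# + ε)
          ≤⟨ proj₂ enough (ℕ.s≤s (ℕ.≮⇒≥ τ≮k)) ⟩
        fromℕ T
          ∎
        where
        L>0 : 0# < L
        L>0 = logℕ-pos n

      failure-bound : 1# - successProbability n k s q T ≤ fromℕ (suc k) * (N ^ k * exp (- (K * L)))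
      failure-bound = UnionBound.failure-bound R r<k q≥0 q≤1 T m θ
        (λ i → bound-nonneg i (i ℕ.≤? τ)) (λ i → tilt-nonneg i (i ℕ.≤? τ)) (K * L) X≥0
        (iterations (suc τ ℕ.≤? k)) (ℕ.≤-trans (ℕ.s≤s ℕ.z≤n) (ℕ.nonTrivial⇒n>1 n)) (λ i _ → tail i (i ℕ.≤? τ))

-- Choice of the constants and the final estimate

module Theorem {c ℓ₁ ℓ₂} (R : RealNumbers c ℓ₁ ℓ₂) where
  open FiniteSets using (C-monoˡ-≤)
  open RealNumbers R
  open GreedyRandomSampling R
  open RealFacts R
  open Estimates R
  open ≤-Reasoning
  open IntegerRingSolver commutativeRing using (solve; :0; :1; _:+_; _:*_; _:-_; :-_; _:=_)

  module _ (k r : ℕ) (r<k : r ℕ.< k) (α : Carrier) (α<1 : α < 1#)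
           (q : ℕ → Carrier) (q-bounds : ∀ n → (0# ≤ q n) × (q n ≤ 1#))
           (a b : Carrier) (a>0 : 0# < a) (b>0 : 0# < b)
           (q-Θ : Eventually (λ n → (a * pow (fromℕ n) (fromℕ-pos′ n) (- α) ≤ q n) ×
                                    (q n ≤ b * pow (fromℕ n) (fromℕ-pos′ n) (- α))))
           (τ : ℕ) (threshold : IsThreshold α (suc r) τ)
           (ε : Carrier) (ε>0 : 0# < ε)
           (T : ℕ → ℕ) (enough : Eventually (λ n → EnoughIterations n k (suc r) τ (q n) ε (T n)))
           (m : ℕ) where

    private
      instance
        k≢0 : ℕ.NonZero k
        k≢0 = ℕ.>-nonZero (ℕ.≤-trans (ℕ.s≤s ℕ.z≤n) r<k)

      K κ θ₀ γ W Y : Carrier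
      K  = fromℕ (suc (m ℕ.+ k))
      κ  = recip (fromℕ k) (fromℕ-pos k)
      -- 4kθ₀ = 1, so the factors exp (2θ₀) of at most k thresholds multiply to at most
      -- exp ½ ≤ 2, the constant in the required number of iterations.
      θ₀ = ½ * (½ * κ)
      -- Up to a constant factor, n^γ is a lower bound for the expected number of common neighbours
      -- of a set of size τ.
      γ  = 1# - α * fromℕ (τ C r)
      -- Chosen so that W (log n)² bounds θ₀² n q^C(τ, s-1) from below, by n^γ ≥ (½ γ log n)². Then
      -- log n ≥ K/W is all that the low sizes require.
      W  = θ₀ * θ₀ * (a ^ (τ C r) * ((½ * γ) * (½ * γ)))
      Y  = K * recip ε ε>0

      θ₀>0 : 0# < θ₀
      θ₀>0 = *-pos ½-pos (*-pos ½-pos (recip-pos _ _))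

      kθ₀ : fromℕ k * (θ₀ + θ₀) ≈ ½
      kθ₀ = trans (*-congˡ (sym (halves (½ * κ)))) (recip-cancel _ _ ½)

      K≥0 : 0# ≤ K
      K≥0 = fromℕ-nonneg (suc (m ℕ.+ k))

      γ>0 : 0# < γ
      γ>0 = x<y⇒0<y-x (proj₁ threshold)

      W>0 : 0# < W
      W>0 = *-pos (*-pos θ₀>0 θ₀>0) (*-pos (^-pos a>0 (τ C r)) (*-pos (*-pos ½-pos γ>0) (*-pos ½-pos γ>0)))

      Y≥0 : 0# ≤ Y
      Y≥0 = *-nonneg K≥0 (<⇒≤ (recip-pos ε ε>0))

      -- Since C(s-1, s-1) = 1 and α < 1, the size s - 1 satisfies the inequality of which τ is the
      -- largest solution.
      r≤τ : r ℕ.≤ τ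
      r≤τ = proj₂ threshold r (<-respˡ-≈ (sym (trans
        (*-congˡ (trans (reflexive (≡.cong fromℕ (nCn≡1 r))) (+-identityʳ 1#))) (*-identityʳ α))) α<1)

      1≤α[1+τ]Cr : 1# ≤ α * fromℕ (suc τ C r)
      1≤α[1+τ]Cr lt = ℕ.<-irrefl ≡.refl (proj₂ threshold (suc τ) lt)

      Large : ∀ n → .{{NonTrivial n}} → Set _
      Large n = (1# ≤ logℕ n) × (fromℕ k ≤ logℕ n) × (K * recip W W>0 ≤ logℕ n) ×
                (exp K * b ^ (suc τ C r) ≤ logℕ n) × (exp Y + 1# ≤ logℕ n)

      large : Eventually Large
      large = Eventually-∩ (logℕ-large _) (Eventually-∩ (logℕ-large _) (Eventually-∩ (logℕ-large _)
        (Eventually-∩ (logℕ-large _) (logℕ-large _))))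

      module _ (n : ℕ) .{{_ : NonTrivial n}}
               (q≥ : a * pow (fromℕ n) (fromℕ-pos′ n) (- α) ≤ q n)
               (q≤ : q n ≤ b * pow (fromℕ n) (fromℕ-pos′ n) (- α)) where

        L = logℕ n

        private
          N = fromℕ n

          q≥0 : 0# ≤ q n
          q≥0 = proj₁ (q-bounds n)

          q≤1 : q n ≤ 1#
          q≤1 = proj₂ (q-bounds n)

          L≥0 : 0# ≤ L
          L≥0 = <⇒≤ (logℕ-pos n)

        -- As q ≤ 1, size τ is the worst case. There the mean is at least a constant times n^γ with
        -- γ > 0, hence at least a constant times (log n)².
        dense : K * recip W W>0 ≤ L → ∀ i → i ℕ.≤ τ → K * L ≤ θ₀ * θ₀ * (N * q n ^ (i C r))
        dense K/W≤L i i≤τ = begin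
          K * L
            ≈⟨ *-congʳ (recip-cancel W W>0 K) ⟨
          W * (K * recip W W>0) * L
            ≤⟨ *-monoʳ-≤ L≥0 (*-monoˡ-≤ (<⇒≤ W>0) K/W≤L) ⟩
          W * L * L
            ≈⟨ solve 4 (λ t a g l → t :* (a :* (g :* g)) :* l :* l := t :* (a :* ((g :* l) :* (g :* l))))
                 refl (θ₀ * θ₀) (a ^ (τ C r)) (½ * γ) L ⟩
          θ₀ * θ₀ * (a ^ (τ C r) * ((½ * γ * L) * (½ * γ * L)))
            ≈⟨ *-congˡ (*-congˡ (*-cong (*-assoc ½ γ L) (*-assoc ½ γ L))) ⟩
          θ₀ * θ₀ * (a ^ (τ C r) * ((½ * (γ * L)) * (½ * (γ * L))))
            ≤⟨ *-monoˡ-≤ θ₀²≥0 (*-monoˡ-≤ (<⇒≤ (^-pos a>0 (τ C r)))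
                 (square-≤-exp (*-nonneg (<⇒≤ γ>0) L≥0))) ⟩
          θ₀ * θ₀ * (a ^ (τ C r) * exp (γ * L))
            ≈⟨ *-congˡ (power-scaling n a α (τ C r)) ⟨
          θ₀ * θ₀ * (N * (a * pow N _ (- α)) ^ (τ C r))
            ≤⟨ *-monoˡ-≤ θ₀²≥0 (*-monoˡ-≤ (fromℕ-nonneg n) (≤-trans
                 (^-monoˡ-≤ (*-nonneg (<⇒≤ a>0) (exp-nonneg _)) q≥ (τ C r))
                 (^-anti-≤ q≥0 q≤1 (C-monoˡ-≤ r i≤τ)))) ⟩
          θ₀ * θ₀ * (N * q n ^ (i C r))
            ∎
          where
          θ₀²≥0 : 0# ≤ θ₀ * θ₀
          θ₀²≥0 = square-nonneg θ₀

        -- As q ≤ 1, size τ + 1 is the worst case. There the exponent 1 - α C(τ+1, s-1) of n is at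
        -- most 0, so the mean is at most the constant b^C(τ+1, s-1), also in the boundary case
        -- where the exponent vanishes.
        sparse : exp K * b ^ (suc τ C r) ≤ L → ∀ i → τ ℕ.< i → exp K * (N * q n ^ (i C r)) ≤ L
        sparse e^Kb≤L i τ<i = begin
          exp K * (N * q n ^ (i C r))
            ≤⟨ *-monoˡ-≤ (exp-nonneg K) (*-monoˡ-≤ (fromℕ-nonneg n) (≤-trans
                 (^-anti-≤ q≥0 q≤1 (C-monoˡ-≤ r τ<i)) (^-monoˡ-≤ q≥0 q≤ (suc τ C r)))) ⟩
          exp K * (N * (b * pow N _ (- α)) ^ (suc τ C r))
            ≈⟨ *-congˡ (power-scaling n b α (suc τ C r)) ⟩
          exp K * (b ^ (suc τ C r) * exp ((1# - α * fromℕ (suc τ C r)) * L))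
            ≤⟨ *-monoˡ-≤ (exp-nonneg K) (*-monoˡ-≤ (<⇒≤ (^-pos b>0 (suc τ C r)))
                 (≤-trans (exp-mono-≤ exponent≤0) (≤-reflexive exp-0))) ⟩
          exp K * (b ^ (suc τ C r) * 1#)
            ≈⟨ *-congˡ (*-identityʳ _) ⟩
          exp K * b ^ (suc τ C r)
            ≤⟨ e^Kb≤L ⟩
          L
            ∎
          where
          exponent≤0 : (1# - α * fromℕ (suc τ C r)) * L ≤ 0#
          exponent≤0 = ≤-trans (*-monoʳ-≤ L≥0 (≤-trans (+-monoˡ-≤ _ 1≤α[1+τ]Cr) (≤-reflexive (-‿inverseʳ _))))
                               (≤-reflexive (zeroˡ L))

        -- The summand `1#` makes `exp Y < x` strict, as `log-≥` demands. All x ≥ log n are covered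
        -- because the estimate is applied both to log n and to 3 log n.
        large-log : exp Y + 1# ≤ L → ∀ x (x>0 : 0# < x) → L ≤ x → (0# ≤ log x x>0) × (K ≤ ε * log x x>0)
        large-log e^Y<L x x>0 L≤x = ≤-trans Y≥0 Y≤log , (begin
          K                ≈⟨ recip-cancel ε ε>0 K ⟨
          ε * Y            ≤⟨ *-monoˡ-≤ (<⇒≤ ε>0) Y≤log ⟩
          ε * log x x>0    ∎)
          where
          Y≤log : Y ≤ log x x>0
          Y≤log = log-≥ x x>0 Y (<-≤-trans
            (<-respʳ-≈ (+-comm 1# _) (<-respˡ-≈ (+-identityˡ _) (+-monoˡ-< (exp Y) 0<1)))
            (≤-trans e^Y<L L≤x))

        -- This fixes the value K = m + k + 1: the union bound costs n^k, the factor k + 1 ≤ 1 + log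
        -- n ≤ n costs one more power of n, and n^(-m) is left.
        union-factor : fromℕ k ≤ L → fromℕ (suc k) * (N ^ k * exp (- (K * L))) ≤ pow N (fromℕ-pos′ n) (- fromℕ m)
        union-factor k≤L = begin
          fromℕ (suc k) * (N ^ k * exp (- (K * L)))
            ≤⟨ *-monoʳ-≤ (*-nonneg (^-nonneg (fromℕ-nonneg n) k) (exp-nonneg _))
                 (≤-trans (+-monoʳ-≤ 1# k≤L) (1+x≤exp L)) ⟩
          exp L * (N ^ k * exp (- (K * L)))
            ≈⟨ *-congˡ (*-congʳ (trans (^-congˡ k (sym (exp-log _ _))) (sym (exp-fromℕ-* k L)))) ⟩
          exp L * (exp (fromℕ k * L) * exp (- (K * L)))
            ≈⟨ trans (*-congˡ (sym (exp-+ _ _))) (sym (exp-+ _ _)) ⟩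
          exp (L + (fromℕ k * L - K * L))
            ≈⟨ exp-cong (trans (+-congˡ (+-congˡ (-‿cong (*-congʳ (+-congˡ (fromℕ-+ m k))))))
                 (solve 3 (λ l k m → l :+ (k :* l :- (:1 :+ (m :+ k)) :* l) := :- m :* l)
                   refl L (fromℕ k) (fromℕ m))) ⟩
          exp (- fromℕ m * L)
            ∎

    failure-superpolynomially-small : Eventually (λ n →
      (0# ≤ 1# - successProbability n k (suc r) (q n) (T n)) ×
      (1# - successProbability n k (suc r) (q n) (T n) ≤ pow (fromℕ n) (fromℕ-pos′ n) (- fromℕ m)))
    failure-superpolynomially-small = Eventually-map
      (λ n ((q≥ , q≤) , iterations , L≥1 , k≤L , K/W≤L , e^Kb≤L , e^Y<L) →
        UnionBound.failure-nonneg R {n} r<k (proj₁ (q-bounds n)) (proj₂ (q-bounds n)) (T n) ,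
        ≤-trans
          (AtSize.failure-bound {n = n} r<k r≤τ (proj₁ (q-bounds n)) (proj₂ (q-bounds n)) (<⇒≤ θ₀>0) kθ₀
            (1≤fromℕ (m ℕ.+ k)) L≥1 (dense n q≥ q≤ K/W≤L) (sparse n q≥ q≤ e^Kb≤L)
            (<⇒≤ ε>0) (large-log n q≥ q≤ e^Y<L) {T n} iterations)
          (union-factor n q≥ q≤ k≤L))
      (Eventually-∩ q-Θ (Eventually-∩ enough large))

theorem5p2 : ∀ {c ℓ₁ ℓ₂} (R : RealNumbers c ℓ₁ ℓ₂) →
    let open RealNumbers R
        open GreedyRandomSampling R in
    (k s : ℕ) → 2 ℕ.≤ s → s ℕ.≤ k →
    (α : Carrier) → 0# < α → α < 1# →
    (q : ℕ → Carrier) → (∀ n → (0# ≤ q n) × (q n ≤ 1#)) →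
    IsΘPow q (- α) →
    (τ : ℕ) → IsThreshold α s τ →
    (ε : Carrier) → 0# < ε →
    (T : ℕ → ℕ) → Eventually (λ n → EnoughIterations n k s τ (q n) ε (T n)) →
    IsSuperpolynomiallySmall (λ n → 1# - successProbability n k s (q n) (T n))
theorem5p2 R k (suc r) _ r<k α _ α<1 q q-bounds (a , b , a>0 , b>0 , q-Θ) τ threshold ε ε>0 T enough =
  Theorem.failure-superpolynomially-small R k r r<k α α<1 q q-bounds a b a>0 b>0 q-Θ τ threshold ε ε>0 T enough
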